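{- Every computably approximable real in $(0,1)$ is strongly c.a. $0$-speedable.
   Context: Conventions: "real" means a real number in the open interval $(0,1)$. An approximation of a real $\alpha$ is a sequence $\{a_s\}_{s\in\omega}$ of rational numbers in $[0,1]$ converging to $\alpha$. It is computable if $a_s$ can be computed from $s$. A real is computably approximable (c.a.) if it has a computable approximation. A computable approximation $\{a_s\}_{s\in\omega}$ of a real $\alpha$ is $0$-speedable via the function $s\mapsto s+1$ if either $\alpha$ is rational, or $\alpha$ is irrational and $$\liminf_{s\to\infty}\left|\frac{\alpha-a_{s+1}}{\alpha-a_s}\right|\le 0 .$$ A real is strongly c.a. $0$-speedable if it has a computable approximation that is $0$-speedable via the function $s\mapsto s+1$. -}

module Defs where

open import Axiom.ExcludedMiddle using (ExcludedMiddle)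
open import Data.Fin.Base using (Fin)
open import Data.Integer.Base using (_⊖_)
open import Data.Nat.Base as ℕ using (ℕ; zero; suc)
import Data.Nat.Properties as ℕₚ
open import Data.Product.Base using (Σ; ∃; _×_; _,_)
open import Data.Rational.Base as ℚ using (ℚ; 0ℚ; 1ℚ; ½)
import Data.Rational.Properties as ℚₚ
open import Data.Rational.Solver using (module +-*-Solver)
open import Data.Sum.Base using (_⊎_; inj₁; inj₂)
open import Data.Vec.Base using (Vec; []; _∷_; lookup)
open import Level using (0ℓ)
open import Relation.Binary.PropositionalEquality.Core
  using (_≡_; refl; sym; trans; cong; subst; subst₂)
open import Relation.Nullary.Decidable.Core using (yes; no; toWitness; decidable-stable)
open import Relation.Nullary.Negation.Core using (¬_; contradiction)

------------------------------------------------------------------------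
-- Computability: partial recursive (μ-recursive) functions

data Rec : ℕ → Set where
  zeroᶠ : ∀ {n} → Rec n
  sucᶠ  : Rec 1
  projᶠ : ∀ {n} → Fin n → Rec n
  comp  : ∀ {m n} → Rec m → Vec (Rec n) m → Rec n
  prim  : ∀ {n} → Rec n → Rec (suc (suc n)) → Rec (suc n)
  μ     : ∀ {n} → Rec (suc n) → Rec n

infix 4 _[_]⇓_ _[_]⇓*_

-- f [ xs ]⇓ y : the computation of f on input xs halts with output y.
mutual
  data _[_]⇓_ : ∀ {n} → Rec n → Vec ℕ n → ℕ → Set where
    zero⇓ : ∀ {n} {xs : Vec ℕ n} → zeroᶠ [ xs ]⇓ 0
    suc⇓  : ∀ {x} → sucᶠ [ x ∷ [] ]⇓ suc x
    proj⇓ : ∀ {n} {xs : Vec ℕ n} (i : Fin n) → projᶠ i [ xs ]⇓ lookup xs i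
    comp⇓ : ∀ {m n} {f : Rec m} {gs : Vec (Rec n) m} {xs ys z} →
            gs [ xs ]⇓* ys → f [ ys ]⇓ z → comp f gs [ xs ]⇓ z
    base⇓ : ∀ {n} {f : Rec n} {g xs y} →
            f [ xs ]⇓ y → prim f g [ 0 ∷ xs ]⇓ y
    step⇓ : ∀ {n} {f : Rec n} {g xs k y z} →
            prim f g [ k ∷ xs ]⇓ y → g [ k ∷ y ∷ xs ]⇓ z →
            prim f g [ suc k ∷ xs ]⇓ z
    μ⇓    : ∀ {n} {f : Rec (suc n)} {xs y} →
            f [ y ∷ xs ]⇓ 0 →
            (∀ z → z ℕ.< y → ∃ λ v → f [ z ∷ xs ]⇓ suc v) →
            μ f [ xs ]⇓ y

  data _[_]⇓*_ {n} : ∀ {m} → Vec (Rec n) m → Vec ℕ n → Vec ℕ m → Set where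
    []⇓ : ∀ {xs} → [] [ xs ]⇓* []
    ∷⇓  : ∀ {m} {g : Rec n} {gs : Vec (Rec n) m} {xs y ys} →
          g [ xs ]⇓ y → gs [ xs ]⇓* ys → (g ∷ gs) [ xs ]⇓* (y ∷ ys)

Computable : (ℕ → ℕ) → Set
Computable f = ∃ λ (c : Rec 1) → ∀ s → c [ s ∷ [] ]⇓ f s

-- Three recursive functions name the terms as (p s - n s) / (1 + d s).
-- The fraction need not be in lowest terms.
ComputableℚSeq : (ℕ → ℚ) → Set
ComputableℚSeq a =
  ∃ λ p → ∃ λ n → ∃ λ d →
    Computable p × Computable n × Computable d ×
    (∀ s → a s ≡ (p s ⊖ n s) ℚ./ suc (d s))

------------------------------------------------------------------------
-- Real numbers: Cauchy sequences of rationals, compared by _≃_.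
-- The order and the apartness are the positive ones; _≤_ and _≃_ are negations.

IsCauchy : (ℕ → ℚ) → Set
IsCauchy x = ∀ ε → 0ℚ ℚ.< ε →
  ∃ λ N → ∀ m n → N ℕ.≤ m → N ℕ.≤ n → ℚ.∣ x m ℚ.- x n ∣ ℚ.< ε

record ℝ : Set where
  constructor mkℝ
  field
    seq    : ℕ → ℚ
    cauchy : IsCauchy seq

open ℝ public

infix 4 _<_ _≤_ _#_ _≃_

_<_ _≤_ _#_ _≃_ : ℝ → ℝ → Set
x < y = ∃ λ ε → 0ℚ ℚ.< ε ×
  ∃ λ N → ∀ n → N ℕ.≤ n → seq x n ℚ.+ ε ℚ.≤ seq y n
x ≤ y = ¬ (y < x)
x # y = x < y ⊎ y < x
x ≃ y = ¬ (x # y)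

fromℚ : ℚ → ℝ
fromℚ q = mkℝ (λ _ → q) λ ε 0<ε →
  0 , λ _ _ _ _ → subst (ℚ._< ε) (sym (cong ℚ.∣_∣ (ℚₚ.+-inverseʳ q))) 0<ε

0ℝ 1ℝ : ℝ
0ℝ = fromℚ 0ℚ
1ℝ = fromℚ 1ℚ

private
  open ℚₚ.≤-Reasoning
  open +-*-Solver

  sub-interchange : ∀ a b c d → (a ℚ.- b) ℚ.- (c ℚ.- d) ≡ (a ℚ.- c) ℚ.- (b ℚ.- d)
  sub-interchange =
    solve 4 (λ a b c d → (a :- b) :- (c :- d) := (a :- c) :- (b :- d)) refl

  mul-difference : ∀ a b c d →
    a ℚ.* b ℚ.- c ℚ.* d ≡ a ℚ.* (b ℚ.- d) ℚ.+ d ℚ.* (a ℚ.- c)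
  mul-difference =
    solve 4 (λ a b c d → a :* b :- c :* d := a :* (b :- d) :+ d :* (a :- c)) refl

  double : ∀ e → e ℚ.+ e ≡ (1ℚ ℚ.+ 1ℚ) ℚ.* e
  double = solve 1 (λ e → e :+ e := (con 1ℚ :+ con 1ℚ) :* e) refl

  cross : ∀ u v p q →
    u ℚ.* (v ℚ.* (q ℚ.- p)) ≡ u ℚ.* (q ℚ.* v) ℚ.- v ℚ.* (p ℚ.* u)
  cross = solve 4 (λ u v p q →
    u :* (v :* (q :- p)) := u :* (q :* v) :- v :* (p :* u)) refl

  mul-ones : ∀ u v → u ℚ.* 1ℚ ℚ.- v ℚ.* 1ℚ ≡ u ℚ.- v
  mul-ones = solve 2 (λ u v → u :* con 1ℚ :- v :* con 1ℚ := u :- v) refl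

  split-sub : ∀ a b → a ≡ (a ℚ.- b) ℚ.+ b
  split-sub = solve 2 (λ a b → a := (a :- b) :+ b) refl

  cancel-sub : ∀ a b → (a ℚ.+ b) ℚ.- b ≡ a
  cancel-sub = solve 2 (λ a b → (a :+ b) :- b := a) refl

  cancel-subˡ : ∀ a b → (a ℚ.+ b) ℚ.- a ≡ b
  cancel-subˡ = solve 2 (λ a b → (a :+ b) :- a := b) refl

  swap-sub : ∀ a q e → (a ℚ.- q) ℚ.+ e ≡ (a ℚ.+ e) ℚ.- q
  swap-sub = solve 3 (λ a q e → (a :- q) :+ e := (a :+ e) :- q) refl

  neg-sub : ∀ p q → ℚ.- (p ℚ.- q) ≡ q ℚ.- p
  neg-sub = solve 2 (λ a b → :- (a :- b) := b :- a) refl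

  *-pos : ∀ {p q} → 0ℚ ℚ.< p → 0ℚ ℚ.< q → 0ℚ ℚ.< p ℚ.* q
  *-pos {p} {q} 0<p 0<q =
    subst (ℚ._< p ℚ.* q) (ℚₚ.*-zeroʳ p)
      (ℚₚ.*-monoʳ-<-pos p {{ℚ.positive 0<p}} 0<q)

  inverse-pos : ∀ K → 0ℚ ℚ.< K → ∃ λ K⁻¹ → 0ℚ ℚ.< K⁻¹ × K ℚ.* K⁻¹ ≡ 1ℚ
  inverse-pos K 0<K = (ℚ.1/ K) , ℚₚ.positive⁻¹ (ℚ.1/ K) {{ℚₚ.1/pos⇒pos K}} ,
                      ℚₚ.*-inverseʳ K
    where instance
      K-pos : ℚ.Positive K
      K-pos = ℚ.positive 0<K
      K-nz : ℚ.NonZero K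
      K-nz = ℚₚ.pos⇒nonZero K

  p≤∣p∣ : ∀ p → p ℚ.≤ ℚ.∣ p ∣
  p≤∣p∣ p with ℚₚ.≤-total 0ℚ p
  ... | inj₁ 0≤p = ℚₚ.≤-reflexive (sym (ℚₚ.0≤p⇒∣p∣≡p 0≤p))
  ... | inj₂ p≤0 = ℚₚ.≤-trans p≤0 (ℚₚ.0≤∣p∣ p)

  abs-*-≤ : ∀ B C p q → 0ℚ ℚ.≤ B → ℚ.∣ p ∣ ℚ.≤ B → ℚ.∣ q ∣ ℚ.≤ C →
            ℚ.∣ p ℚ.* q ∣ ℚ.≤ B ℚ.* C
  abs-*-≤ B C p q 0≤B p≤B q≤C = begin
    ℚ.∣ p ℚ.* q ∣        ≡⟨ ℚₚ.∣p*q∣≡∣p∣*∣q∣ p q ⟩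
    ℚ.∣ p ∣ ℚ.* ℚ.∣ q ∣  ≤⟨ ℚₚ.*-monoʳ-≤-nonNeg ℚ.∣ q ∣ {{ℚₚ.∣-∣-nonNeg q}} p≤B ⟩
    B ℚ.* ℚ.∣ q ∣        ≤⟨ ℚₚ.*-monoˡ-≤-nonNeg B {{ℚ.nonNegative 0≤B}} q≤C ⟩
    B ℚ.* C              ∎

  abs-sub-≤ : ∀ p q → ℚ.∣ p ∣ ℚ.- ℚ.∣ q ∣ ℚ.≤ ℚ.∣ p ℚ.- q ∣
  abs-sub-≤ p q = begin
    ℚ.∣ p ∣ ℚ.- ℚ.∣ q ∣
      ≡⟨ cong (λ t → ℚ.∣ t ∣ ℚ.- ℚ.∣ q ∣) (split-sub p q) ⟩
    ℚ.∣ (p ℚ.- q) ℚ.+ q ∣ ℚ.- ℚ.∣ q ∣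
      ≤⟨ ℚₚ.+-monoˡ-≤ (ℚ.- ℚ.∣ q ∣) (ℚₚ.∣p+q∣≤∣p∣+∣q∣ (p ℚ.- q) q) ⟩
    (ℚ.∣ p ℚ.- q ∣ ℚ.+ ℚ.∣ q ∣) ℚ.- ℚ.∣ q ∣
      ≡⟨ cancel-sub ℚ.∣ p ℚ.- q ∣ ℚ.∣ q ∣ ⟩
    ℚ.∣ p ℚ.- q ∣ ∎

  abs-abs : ∀ p q → ℚ.∣ ℚ.∣ p ∣ ℚ.- ℚ.∣ q ∣ ∣ ℚ.≤ ℚ.∣ p ℚ.- q ∣
  abs-abs p q with ℚₚ.∣p∣≡p∨∣p∣≡-p (ℚ.∣ p ∣ ℚ.- ℚ.∣ q ∣)
  ... | inj₁ eq = ℚₚ.≤-trans (ℚₚ.≤-reflexive eq) (abs-sub-≤ p q)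
  ... | inj₂ eq = begin
    ℚ.∣ ℚ.∣ p ∣ ℚ.- ℚ.∣ q ∣ ∣    ≡⟨ eq ⟩
    ℚ.- (ℚ.∣ p ∣ ℚ.- ℚ.∣ q ∣)    ≡⟨ neg-sub ℚ.∣ p ∣ ℚ.∣ q ∣ ⟩
    ℚ.∣ q ∣ ℚ.- ℚ.∣ p ∣          ≤⟨ abs-sub-≤ q p ⟩
    ℚ.∣ q ℚ.- p ∣                ≡⟨ cong ℚ.∣_∣ (sym (neg-sub p q)) ⟩
    ℚ.∣ ℚ.- (p ℚ.- q) ∣          ≡⟨ ℚₚ.∣-p∣≡∣p∣ (p ℚ.- q) ⟩
    ℚ.∣ p ℚ.- q ∣                ∎

  CauchyBound : ℚ → (ℕ → ℚ) → ℚ → Set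
  CauchyBound K x ε = ∃ λ N → ∀ m n → N ℕ.≤ m → N ℕ.≤ n →
    ℚ.∣ x m ℚ.- x n ∣ ℚ.≤ K ℚ.* ε

  rescale : ∀ K → 0ℚ ℚ.< K → (x : ℕ → ℚ) →
    (∀ ε → 0ℚ ℚ.< ε → CauchyBound K x ε) → IsCauchy x
  rescale K 0<K x h ε 0<ε with inverse-pos K 0<K
  ... | K⁻¹ , 0<K⁻¹ , KK⁻¹≡1 with h (K⁻¹ ℚ.* (½ ℚ.* ε)) (*-pos 0<K⁻¹ 0<½ε)
    where
    0<½ε : 0ℚ ℚ.< ½ ℚ.* ε
    0<½ε = *-pos {½} (ℚₚ.positive⁻¹ ½) 0<ε
  ... | N , b = N , λ m n N≤m N≤n → begin-strict
    ℚ.∣ x m ℚ.- x n ∣          ≤⟨ b m n N≤m N≤n ⟩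
    K ℚ.* (K⁻¹ ℚ.* (½ ℚ.* ε))  ≡⟨ sym (ℚₚ.*-assoc K K⁻¹ _) ⟩
    (K ℚ.* K⁻¹) ℚ.* (½ ℚ.* ε)  ≡⟨ cong (ℚ._* (½ ℚ.* ε)) KK⁻¹≡1 ⟩
    1ℚ ℚ.* (½ ℚ.* ε)           ≡⟨ ℚₚ.*-identityˡ _ ⟩
    ½ ℚ.* ε                    <⟨ ℚₚ.*-monoˡ-<-pos ε {{ℚ.positive 0<ε}} {½} {1ℚ} ½<1 ⟩
    1ℚ ℚ.* ε                   ≡⟨ ℚₚ.*-identityˡ ε ⟩
    ε                          ∎
    where
    ½<1 : ½ ℚ.< 1ℚ
    ½<1 = toWitness {a? = ½ ℚₚ.<? 1ℚ} _

  bounded : (x : ℝ) → ∃ λ B → 0ℚ ℚ.< B ×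
    ∃ λ N → ∀ n → N ℕ.≤ n → ℚ.∣ seq x n ∣ ℚ.≤ B
  bounded x with cauchy x 1ℚ (ℚₚ.positive⁻¹ 1ℚ)
  ... | N , h = 1ℚ ℚ.+ ℚ.∣ seq x N ∣ ,
    ℚₚ.+-mono-<-≤ (ℚₚ.positive⁻¹ 1ℚ) (ℚₚ.0≤∣p∣ (seq x N)) , N , λ n N≤n → begin
      ℚ.∣ seq x n ∣
        ≡⟨ cong ℚ.∣_∣ (split-sub (seq x n) (seq x N)) ⟩
      ℚ.∣ (seq x n ℚ.- seq x N) ℚ.+ seq x N ∣
        ≤⟨ ℚₚ.∣p+q∣≤∣p∣+∣q∣ (seq x n ℚ.- seq x N) (seq x N) ⟩
      ℚ.∣ seq x n ℚ.- seq x N ∣ ℚ.+ ℚ.∣ seq x N ∣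
        ≤⟨ ℚₚ.+-monoˡ-≤ ℚ.∣ seq x N ∣ (ℚₚ.<⇒≤ (h n N N≤n ℕₚ.≤-refl)) ⟩
      1ℚ ℚ.+ ℚ.∣ seq x N ∣ ∎

  sub-estimate : ∀ ε a b c d → ℚ.∣ a ℚ.- c ∣ ℚ.≤ ε → ℚ.∣ b ℚ.- d ∣ ℚ.≤ ε →
    ℚ.∣ (a ℚ.- b) ℚ.- (c ℚ.- d) ∣ ℚ.≤ (1ℚ ℚ.+ 1ℚ) ℚ.* ε
  sub-estimate ε a b c d ac bd =
    subst₂ ℚ._≤_ (cong ℚ.∣_∣ (sym (sub-interchange a b c d))) (double ε)
      (ℚₚ.≤-trans (ℚₚ.∣p-q∣≤∣p∣+∣q∣ (a ℚ.- c) (b ℚ.- d)) (ℚₚ.+-mono-≤ ac bd))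

  sub-cauchy : ∀ x y → IsCauchy (λ n → seq x n ℚ.- seq y n)
  sub-cauchy x y =
    rescale (1ℚ ℚ.+ 1ℚ) (ℚₚ.positive⁻¹ (1ℚ ℚ.+ 1ℚ)) (λ n → seq x n ℚ.- seq y n) λ ε 0<ε →
      let N , h = cauchy x ε 0<ε
          M , k = cauchy y ε 0<ε
      in N ℕ.⊔ M , λ m n ≤m ≤n →
      sub-estimate ε (seq x m) (seq y m) (seq x n) (seq y n)
        (ℚₚ.<⇒≤ (h m n (ℕₚ.m⊔n≤o⇒m≤o N M ≤m) (ℕₚ.m⊔n≤o⇒m≤o N M ≤n)))
        (ℚₚ.<⇒≤ (k m n (ℕₚ.m⊔n≤o⇒n≤o N M ≤m) (ℕₚ.m⊔n≤o⇒n≤o N M ≤n)))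

  mul-estimate : ∀ B C ε a b c d → 0ℚ ℚ.≤ B → 0ℚ ℚ.≤ C →
    ℚ.∣ a ∣ ℚ.≤ B → ℚ.∣ d ∣ ℚ.≤ C →
    ℚ.∣ a ℚ.- c ∣ ℚ.≤ ε → ℚ.∣ b ℚ.- d ∣ ℚ.≤ ε →
    ℚ.∣ a ℚ.* b ℚ.- c ℚ.* d ∣ ℚ.≤ (B ℚ.+ C) ℚ.* ε
  mul-estimate B C ε a b c d 0≤B 0≤C a≤B d≤C ac bd =
    subst₂ ℚ._≤_ (cong ℚ.∣_∣ (sym (mul-difference a b c d))) (sym (ℚₚ.*-distribʳ-+ ε B C))
      (ℚₚ.≤-trans (ℚₚ.∣p+q∣≤∣p∣+∣q∣ (a ℚ.* (b ℚ.- d)) (d ℚ.* (a ℚ.- c)))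
        (ℚₚ.+-mono-≤
          {ℚ.∣ a ℚ.* (b ℚ.- d) ∣} {B ℚ.* ε} {ℚ.∣ d ℚ.* (a ℚ.- c) ∣} {C ℚ.* ε}
          (abs-*-≤ B ε a (b ℚ.- d) 0≤B a≤B bd)
          (abs-*-≤ C ε d (a ℚ.- c) 0≤C d≤C ac)))

  mul-cauchy : ∀ x y → IsCauchy (λ n → seq x n ℚ.* seq y n)
  mul-cauchy x y =
    let B , 0<B , P , hB = bounded x
        C , 0<C , Q , hC = bounded y
    in rescale (B ℚ.+ C) (ℚₚ.+-mono-< 0<B 0<C) (λ n → seq x n ℚ.* seq y n) λ ε 0<ε →
      let N , h = cauchy x ε 0<ε
          M , k = cauchy y ε 0<ε
      in (N ℕ.⊔ M) ℕ.⊔ (P ℕ.⊔ Q) , λ m n ≤m ≤n →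
      let NMm = ℕₚ.m⊔n≤o⇒m≤o (N ℕ.⊔ M) (P ℕ.⊔ Q) ≤m
          NMn = ℕₚ.m⊔n≤o⇒m≤o (N ℕ.⊔ M) (P ℕ.⊔ Q) ≤n
          PQm = ℕₚ.m⊔n≤o⇒n≤o (N ℕ.⊔ M) (P ℕ.⊔ Q) ≤m
          PQn = ℕₚ.m⊔n≤o⇒n≤o (N ℕ.⊔ M) (P ℕ.⊔ Q) ≤n
      in mul-estimate B C ε (seq x m) (seq y m) (seq x n) (seq y n)
           (ℚₚ.<⇒≤ 0<B) (ℚₚ.<⇒≤ 0<C)
           (hB m (ℕₚ.m⊔n≤o⇒m≤o P Q PQm))
           (hC n (ℕₚ.m⊔n≤o⇒n≤o P Q PQn))
           (ℚₚ.<⇒≤ (h m n (ℕₚ.m⊔n≤o⇒m≤o N M NMm) (ℕₚ.m⊔n≤o⇒m≤o N M NMn)))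
           (ℚₚ.<⇒≤ (k m n (ℕₚ.m⊔n≤o⇒n≤o N M NMm) (ℕₚ.m⊔n≤o⇒n≤o N M NMn)))

  abs-cauchy : ∀ x → IsCauchy (λ n → ℚ.∣ seq x n ∣)
  abs-cauchy x ε 0<ε with cauchy x ε 0<ε
  ... | N , h = N , λ m n N≤m N≤n →
    ℚₚ.≤-<-trans (abs-abs (seq x m) (seq x n)) (h m n N≤m N≤n)

-- A sequence with nonzero limit may have finitely many zero terms; the value at 0
-- only fills those in.
recip : ℚ → ℚ
recip q with q ℚₚ.≟ 0ℚ
... | yes _  = 0ℚ
... | no q≢0 = (ℚ.1/ q) {{ℚ.≢-nonZero q≢0}}

private
  recip-inverse : ∀ q → ¬ (q ≡ 0ℚ) → q ℚ.* recip q ≡ 1ℚ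
  recip-inverse q q≢0 with q ℚₚ.≟ 0ℚ
  ... | yes q≡0  = contradiction q≡0 q≢0
  ... | no  q≢0′ = ℚₚ.*-inverseʳ q {{ℚ.≢-nonZero q≢0′}}

  awayFromZero : ∀ x → x # 0ℝ → ∃ λ δ → 0ℚ ℚ.< δ ×
    ∃ λ N → ∀ n → N ℕ.≤ n → δ ℚ.≤ ℚ.∣ seq x n ∣
  awayFromZero x (inj₁ (δ , 0<δ , N , h)) = δ , 0<δ , N , λ n N≤n → begin
    δ                    ≡⟨ sym (cancel-subˡ (seq x n) δ) ⟩
    (seq x n ℚ.+ δ) ℚ.- seq x n ≤⟨ ℚₚ.+-monoˡ-≤ (ℚ.- seq x n) (h n N≤n) ⟩
    0ℚ ℚ.- seq x n       ≡⟨ ℚₚ.+-identityˡ _ ⟩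
    ℚ.- seq x n          ≤⟨ p≤∣p∣ (ℚ.- seq x n) ⟩
    ℚ.∣ ℚ.- seq x n ∣    ≡⟨ ℚₚ.∣-p∣≡∣p∣ (seq x n) ⟩
    ℚ.∣ seq x n ∣        ∎
  awayFromZero x (inj₂ (δ , 0<δ , N , h)) = δ , 0<δ , N , λ n N≤n → begin
    δ              ≡⟨ sym (ℚₚ.+-identityˡ δ) ⟩
    0ℚ ℚ.+ δ       ≤⟨ h n N≤n ⟩
    seq x n        ≤⟨ p≤∣p∣ (seq x n) ⟩
    ℚ.∣ seq x n ∣  ∎

  δ≤∣q∣⇒q≢0 : ∀ {δ q} → 0ℚ ℚ.< δ → δ ℚ.≤ ℚ.∣ q ∣ → ¬ (q ≡ 0ℚ)
  δ≤∣q∣⇒q≢0 0<δ δ≤ refl = ℚₚ.<-irrefl refl (ℚₚ.<-≤-trans 0<δ δ≤)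

  recip-bound : ∀ {δ δ⁻¹} q → 0ℚ ℚ.< δ → 0ℚ ℚ.< δ⁻¹ → δ ℚ.* δ⁻¹ ≡ 1ℚ →
                δ ℚ.≤ ℚ.∣ q ∣ → ℚ.∣ recip q ∣ ℚ.≤ δ⁻¹
  recip-bound {δ} {δ⁻¹} q 0<δ 0<δ⁻¹ eq δ≤ =
    ℚₚ.*-cancelˡ-≤-pos δ {{ℚ.positive 0<δ}} (begin
      δ ℚ.* ℚ.∣ recip q ∣
        ≤⟨ ℚₚ.*-monoʳ-≤-nonNeg ℚ.∣ recip q ∣ {{ℚₚ.∣-∣-nonNeg (recip q)}} δ≤ ⟩
      ℚ.∣ q ∣ ℚ.* ℚ.∣ recip q ∣  ≡⟨ sym (ℚₚ.∣p*q∣≡∣p∣*∣q∣ q (recip q)) ⟩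
      ℚ.∣ q ℚ.* recip q ∣        ≡⟨ cong ℚ.∣_∣ (recip-inverse q (δ≤∣q∣⇒q≢0 0<δ δ≤)) ⟩
      1ℚ                         ≡⟨ sym eq ⟩
      δ ℚ.* δ⁻¹                  ∎)

  recip-diff : ∀ p q → ¬ (p ≡ 0ℚ) → ¬ (q ≡ 0ℚ) →
    recip p ℚ.- recip q ≡ recip p ℚ.* (recip q ℚ.* (q ℚ.- p))
  recip-diff p q p≢0 q≢0 = sym (begin-equality
    u ℚ.* (v ℚ.* (q ℚ.- p))
      ≡⟨ cross u v p q ⟩
    u ℚ.* (q ℚ.* v) ℚ.- v ℚ.* (p ℚ.* u)
      ≡⟨ cong (λ t → u ℚ.* t ℚ.- v ℚ.* (p ℚ.* u)) (recip-inverse q q≢0) ⟩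
    u ℚ.* 1ℚ ℚ.- v ℚ.* (p ℚ.* u)
      ≡⟨ cong (λ t → u ℚ.* 1ℚ ℚ.- v ℚ.* t) (recip-inverse p p≢0) ⟩
    u ℚ.* 1ℚ ℚ.- v ℚ.* 1ℚ
      ≡⟨ mul-ones u v ⟩
    u ℚ.- v ∎)
    where
    u = recip p
    v = recip q

  recip-estimate : ∀ K ε p q → 0ℚ ℚ.≤ K → ¬ (p ≡ 0ℚ) → ¬ (q ≡ 0ℚ) →
    ℚ.∣ recip p ∣ ℚ.≤ K → ℚ.∣ recip q ∣ ℚ.≤ K → ℚ.∣ q ℚ.- p ∣ ℚ.≤ ε →
    ℚ.∣ recip p ℚ.- recip q ∣ ℚ.≤ (K ℚ.* K) ℚ.* ε
  recip-estimate K ε p q 0≤K p≢0 q≢0 p≤K q≤K qp =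
    subst₂ ℚ._≤_ (cong ℚ.∣_∣ (sym (recip-diff p q p≢0 q≢0))) (sym (ℚₚ.*-assoc K K ε))
      (abs-*-≤ K (K ℚ.* ε) (recip p) (recip q ℚ.* (q ℚ.- p)) 0≤K p≤K
        (abs-*-≤ K ε (recip q) (q ℚ.- p) 0≤K q≤K qp))

  recip-cauchy : ∀ x → x # 0ℝ → IsCauchy (λ n → recip (seq x n))
  recip-cauchy x x#0 =
    let δ , 0<δ , N , h     = awayFromZero x x#0
        K , 0<K , δK≡1      = inverse-pos δ 0<δ
    in rescale (K ℚ.* K) (*-pos 0<K 0<K) (λ n → recip (seq x n)) λ ε 0<ε →
      let M , k = cauchy x ε 0<ε
      in N ℕ.⊔ M , λ m n ≤m ≤n →
      let hm = h m (ℕₚ.m⊔n≤o⇒m≤o N M ≤m)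
          hn = h n (ℕₚ.m⊔n≤o⇒m≤o N M ≤n)
      in recip-estimate K ε (seq x m) (seq x n) (ℚₚ.<⇒≤ 0<K)
           (δ≤∣q∣⇒q≢0 0<δ hm) (δ≤∣q∣⇒q≢0 0<δ hn)
           (recip-bound (seq x m) 0<δ 0<K δK≡1 hm)
           (recip-bound (seq x n) 0<δ 0<K δK≡1 hn)
           (ℚₚ.<⇒≤ (k n m (ℕₚ.m⊔n≤o⇒n≤o N M ≤n) (ℕₚ.m⊔n≤o⇒n≤o N M ≤m)))

infixl 6 _-_
infixl 7 _*_ _÷_[_]

_-_ _*_ : ℝ → ℝ → ℝ
x - y = mkℝ (λ n → seq x n ℚ.- seq y n) (sub-cauchy x y)
x * y = mkℝ (λ n → seq x n ℚ.* seq y n) (mul-cauchy x y)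

∣_∣ : ℝ → ℝ
∣ x ∣ = mkℝ (λ n → ℚ.∣ seq x n ∣) (abs-cauchy x)

_⁻¹[_] : (x : ℝ) → x # 0ℝ → ℝ
x ⁻¹[ x#0 ] = mkℝ (λ n → recip (seq x n)) (recip-cauchy x x#0)

_÷_[_] : (x y : ℝ) → y # 0ℝ → ℝ
x ÷ y [ y#0 ] = x * y ⁻¹[ y#0 ]

IsInf IsSup IsLiminf : (ℕ → ℝ) → ℝ → Set
IsInf x i = (∀ n → i ≤ x n) × (∀ j → (∀ n → j ≤ x n) → j ≤ i)
IsSup x i = (∀ n → x n ≤ i) × (∀ j → (∀ n → x n ≤ j) → i ≤ j)

-- ℓ = sup over N of the infimum of x N , x (N + 1) , …
IsLiminf x ℓ = ∃ λ i → (∀ N → IsInf (λ k → x (N ℕ.+ k)) (i N)) × IsSup i ℓ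

-- A sequence bounded below cannot have lower limit -∞, so for it lim inf x ≤ c
-- means that the lower limit is a real number and is at most c.
Liminf_≤_ : (ℕ → ℝ) → ℝ → Set
Liminf x ≤ c = ∃ λ ℓ → IsLiminf x ℓ × ℓ ≤ c

Rational Irrational : ℝ → Set
Rational α = ∃ λ q → α ≃ fromℚ q
Irrational α = ¬ Rational α

------------------------------------------------------------------------
-- Approximations and speedability

_⟶_ : (ℕ → ℚ) → ℝ → Set
a ⟶ α = ∀ ε → 0ℝ < ε → ∃ λ N → ∀ s → N ℕ.≤ s → ∣ fromℚ (a s) - α ∣ < ε

record IsComputableApproximation (a : ℕ → ℚ) (α : ℝ) : Set where
  field
    0≤a        : ∀ s → 0ℚ ℚ.≤ a s
    a≤1        : ∀ s → a s ℚ.≤ 1ℚ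
    converges  : a ⟶ α
    computable : ComputableℚSeq a

ComputablyApproximable : ℝ → Set
ComputablyApproximable α = ∃ λ a → IsComputableApproximation a α

-- Excluded middle turns the negation of equality into the apartness that
-- division asks for.
irrational⇒# : ExcludedMiddle 0ℓ → ∀ {α} → Irrational α →
               ∀ q → α - fromℚ q # 0ℝ
irrational⇒# em {α} irr q = shift (decidable-stable (em {α # fromℚ q}) λ α≃q → irr (q , α≃q))
  where
  shift : α # fromℚ q → α - fromℚ q # 0ℝ
  shift (inj₁ (ε , 0<ε , N , h)) = inj₁ (ε , 0<ε , N , λ n N≤n → begin
    (seq α n ℚ.- q) ℚ.+ ε  ≡⟨ swap-sub (seq α n) q ε ⟩
    (seq α n ℚ.+ ε) ℚ.- q  ≤⟨ ℚₚ.+-monoˡ-≤ (ℚ.- q) (h n N≤n) ⟩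
    q ℚ.- q                ≡⟨ ℚₚ.+-inverseʳ q ⟩
    0ℚ                     ∎)
  shift (inj₂ (ε , 0<ε , N , h)) = inj₂ (ε , 0<ε , N , λ n N≤n → begin
    0ℚ ℚ.+ ε         ≡⟨ trans (ℚₚ.+-identityˡ ε) (sym (cancel-subˡ q ε)) ⟩
    (q ℚ.+ ε) ℚ.- q  ≤⟨ ℚₚ.+-monoˡ-≤ (ℚ.- q) (h n N≤n) ⟩
    seq α n ℚ.- q    ∎)

ratio : ExcludedMiddle 0ℓ → (a : ℕ → ℚ) (α : ℝ) → Irrational α → ℕ → ℝ
ratio em a α irr s =
  ∣ (α - fromℚ (a (suc s))) ÷ (α - fromℚ (a s)) [ irrational⇒# em {α} irr (a s) ] ∣

ZeroSpeedableViaSuc : ExcludedMiddle 0ℓ → (ℕ → ℚ) → ℝ → Set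
ZeroSpeedableViaSuc em a α =
  Rational α ⊎ Σ (Irrational α) λ irr → Liminf (ratio em a α irr) ≤ 0ℝ

StronglyCAZeroSpeedable : ExcludedMiddle 0ℓ → ℝ → Set
StronglyCAZeroSpeedable em α =
  ∃ λ a → IsComputableApproximation a α × ZeroSpeedableViaSuc em a α

{-# OPTIONS --safe #-}
-- Let a be a computable approximation of an irrational α. For each k round a s down to a
-- multiple of 1/(k+1)²; since α is irrational the rounded value is eventually constant in s.
-- Let level s be the least k at which the rounded values of a s and a (s+1) differ (or s, if
-- there is no smaller such k), so that level s → ∞. The new approximation lists, for each s,
-- the detour a (s+1) · k/(k+1) with k = level s and then a (s+1) itself. Infinitely often
-- level t is smaller than all later levels. The rounding at level k = level t is then
-- constant after t, so a (t+1) is within 1/(k+1)² of α up to a constant factor, whereas the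
-- detour is off by about α/(k+1): the ratio at this stage is of order 1/(k+1).
module Submission where

open import Axiom.ExcludedMiddle using (ExcludedMiddle)
open import Data.Fin.Base using (Fin)
open import Data.Fin.Patterns using (0F; 1F; 2F)
open import Data.Integer.Base as ℤ using (+_; _⊖_)
import Data.Integer.Properties as ℤₚ
open import Data.Nat.Base as ℕ using (ℕ; zero; suc; z≤n; s≤s; _∸_; _/_)
import Data.Nat.DivMod as ℕ
import Data.Nat.Properties as ℕₚ
open import Data.Product.Base using (∃; _×_; _,_; proj₁; proj₂)
open import Data.Rational.Base as ℚ using (ℚ; 0ℚ; 1ℚ; ½; mkℚ; fromℚᵘ)
import Data.Rational.Properties as ℚₚ
open import Data.Rational.Solver using (module +-*-Solver)
open import Data.Rational.Unnormalised.Base as ℚᵘ using (mkℚᵘ; *≡*; *≤*; *<*)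
import Data.Rational.Unnormalised.Properties as ℚᵘₚ
open import Data.Sum.Base using (_⊎_; inj₁; inj₂)
open import Data.Vec.Base using (Vec; []; _∷_; lookup)
open import Level using (0ℓ)
open import Relation.Binary.PropositionalEquality.Core
  using (_≡_; _≢_; refl; sym; trans; cong; cong₂; subst; subst₂)
open import Relation.Nullary.Decidable.Core using (yes; no; decidable-stable)
open import Relation.Nullary.Negation.Core using (¬_; contradiction)
open import Defs

open +-*-Solver using (solve; con; _:=_; _:+_; _:*_; _:-_; :-_)

-- Recursive functions

-- Taking the whole vector of variables as argument makes a function recursive by following its
-- term: `var` at the leaves, `apply` and `apply₂` at the nodes.
Recursive : ∀ {n} → (Vec ℕ n → ℕ) → Set
Recursive {n} f = ∃ λ (c : Rec n) → ∀ xs → c [ xs ]⇓ f xs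

Computable₂ : (ℕ → ℕ → ℕ) → Set
Computable₂ f = ∃ λ (c : Rec 2) → ∀ x y → c [ x ∷ y ∷ [] ]⇓ f x y

var : ∀ {n} (i : Fin n) → Recursive (λ xs → lookup xs i)
var i = projᶠ i , λ _ → proj⇓ i

apply : ∀ {n f} {g : Vec ℕ n → ℕ} → Computable f → Recursive g → Recursive (λ xs → f (g xs))
apply (c , h) (d , k) = comp c (d ∷ []) , λ xs → comp⇓ (∷⇓ (k xs) []⇓) (h _)

apply₂ : ∀ {n f} {g h : Vec ℕ n → ℕ} → Computable₂ f → Recursive g → Recursive h →
         Recursive (λ xs → f (g xs) (h xs))
apply₂ (c , r) (d , k) (e , l) =
  comp c (d ∷ e ∷ []) , λ xs → comp⇓ (∷⇓ (k xs) (∷⇓ (l xs) []⇓)) (r _ _)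

curried : ∀ {f} → Recursive {1} (λ xs → f (lookup xs 0F)) → Computable f
curried (c , h) = c , λ s → h (s ∷ [])

curried₂ : ∀ {f} → Recursive {2} (λ xs → f (lookup xs 0F) (lookup xs 1F)) → Computable₂ f
curried₂ (c , h) = c , λ x y → h (x ∷ y ∷ [])

suc-computable : Computable suc
suc-computable = sucᶠ , λ _ → suc⇓

const-recursive : ∀ {n} k → Recursive {n} (λ _ → k)
const-recursive zero    = zeroᶠ , λ _ → zero⇓
const-recursive (suc k) = apply suc-computable (const-recursive k)

primRec : ∀ {h : ℕ → ℕ} (g : Vec ℕ 2 → ℕ) → Recursive g →
          (∀ k → h (suc k) ≡ g (k ∷ h k ∷ [])) → Computable h
primRec {h} g (c , r) eq = prim (proj₁ (const-recursive (h 0))) c , go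
  where
  go : ∀ k → prim (proj₁ (const-recursive (h 0))) c [ k ∷ [] ]⇓ h k
  go zero    = base⇓ (proj₂ (const-recursive (h 0)) [])
  go (suc k) rewrite eq k = step⇓ (go k) (r _)

primRec₂ : ∀ {h : ℕ → ℕ → ℕ} {f : ℕ → ℕ} (g : Vec ℕ 3 → ℕ) → Computable f → Recursive g →
           (∀ y → h 0 y ≡ f y) → (∀ k y → h (suc k) y ≡ g (k ∷ h k y ∷ y ∷ [])) →
           Computable₂ h
primRec₂ {h} g (b , q) (c , r) eq₀ eq = prim b c , go
  where
  go : ∀ k y → prim b c [ k ∷ y ∷ [] ]⇓ h k y
  go zero    y rewrite eq₀ y  = base⇓ (q y)
  go (suc k) y rewrite eq k y = step⇓ (go k y) (r _)

μ-recursive : ∀ {n h} (f : Vec ℕ (suc n) → ℕ) → Recursive f →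
              (∀ xs → f (h xs ∷ xs) ≡ 0) → (∀ xs z → z ℕ.< h xs → f (z ∷ xs) ≢ 0) →
              Recursive h
μ-recursive {h = h} f (c , r) eq₀ below = μ c , λ xs →
  μ⇓ (subst (c [ h xs ∷ xs ]⇓_) (eq₀ xs) (r _)) λ z z<h →
    -- `μ⇓` wants every earlier value in the form `suc v`; for a nonzero value, `v` is its
    -- predecessor.
    let instance _ = ℕ.≢-nonZero (below xs z z<h)
    in ℕ.pred (f (z ∷ xs)) ,
       subst (c [ z ∷ xs ]⇓_) (sym (ℕₚ.suc-pred (f (z ∷ xs)))) (r _)

+-computable : Computable₂ ℕ._+_
+-computable = primRec₂ _ (curried (var 0F)) (apply suc-computable (var 1F))
  (λ _ → refl) (λ _ _ → refl)

*-computable : Computable₂ ℕ._*_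
*-computable = primRec₂ _ (curried (const-recursive 0)) (apply₂ +-computable (var 2F) (var 1F))
  (λ _ → refl) (λ _ _ → refl)

pred-computable : Computable ℕ.pred
pred-computable = primRec _ (var 0F) (λ _ → refl)

-- `primRec₂` recurses on the first argument, whereas subtraction iterates `pred` along its second,
-- so the flipped function comes first.
∸-computable : Computable₂ _∸_
∸-computable = curried₂ (apply₂ flipped (var 1F) (var 0F))
  where
  flipped : Computable₂ (λ y x → x ∸ y)
  flipped = primRec₂ _ (curried (var 0F)) (apply pred-computable (var 1F))
    (λ _ → refl) (λ k y → sym (ℕₚ.pred[m∸n]≡m∸[1+n] y k))

m<[1+m/n]*n : ∀ m d → m ℕ.< suc (m / suc d) ℕ.* suc d
m<[1+m/n]*n m d = subst (ℕ._< suc (m / suc d) ℕ.* suc d) (sym (ℕ.m≡m%n+[m/n]*n m (suc d)))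
  (ℕₚ.+-monoˡ-< (m / suc d ℕ.* suc d) (ℕ.m%n<n m (suc d)))

-- The quotient is the least `q` with `x < suc q * suc d`, that is, the least zero of
-- `suc x ∸ suc q * suc d`.
/-computable : Computable₂ (λ x d → x / suc d)
/-computable = curried₂ (μ-recursive _
  (apply₂ ∸-computable (apply suc-computable (var 1F))
    (apply₂ *-computable (apply suc-computable (var 0F)) (apply suc-computable (var 2F))))
  (λ { (x ∷ d ∷ []) → ℕₚ.m≤n⇒m∸n≡0 (m<[1+m/n]*n x d) })
  (λ { (x ∷ d ∷ []) z z<q eq → ℕₚ.<⇒≱ z<q
    (ℕ.s≤s⁻¹ (ℕ.m<n*o⇒m/o<n {x} {suc z} {suc d} (ℕₚ.m∸n≡0⇒m≤n eq))) }))


-- Bounded search and distance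

leastZero : (f : ℕ → ℕ) (n : ℕ) → f n ≡ 0 → ∃ λ k → f k ≡ 0 × (∀ j → j ℕ.< k → f j ≢ 0)
leastZero f zero    fn≡0 = 0 , fn≡0 , λ _ ()
leastZero f (suc n) fn≡0 with f 0 ℕₚ.≟ 0
... | yes f0≡0 = 0 , f0≡0 , λ _ ()
... | no  f0≢0 with leastZero (λ i → f (suc i)) n fn≡0
...   | k , fk≡0 , below = suc k , fk≡0 , λ where
  zero    _         → f0≢0
  (suc j) (s≤s j<k) → below j j<k

distance : ℕ → ℕ → ℕ
distance m n = (m ∸ n) ℕ.+ (n ∸ m)

distance≡0⇒≡ : ∀ m n → distance m n ≡ 0 → m ≡ n
distance≡0⇒≡ m n eq = ℕₚ.≤-antisym
  (ℕₚ.m∸n≡0⇒m≤n (ℕₚ.m+n≡0⇒m≡0 (m ∸ n) eq))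
  (ℕₚ.m∸n≡0⇒m≤n (ℕₚ.m+n≡0⇒n≡0 (m ∸ n) eq))

distance-refl : ∀ n → distance n n ≡ 0
distance-refl n rewrite ℕₚ.n∸n≡0 n = refl

-- Eventual behaviour of sequences

Eventually : (ℕ → Set) → Set
Eventually P = ∃ λ N → ∀ s → N ℕ.≤ s → P s

eventually-× : ∀ {P Q} → Eventually P → Eventually Q → Eventually (λ s → P s × Q s)
eventually-× (M , p) (N , q) = M ℕ.⊔ N , λ s ≤s →
  p s (ℕₚ.m⊔n≤o⇒m≤o M N ≤s) , q s (ℕₚ.m⊔n≤o⇒n≤o M N ≤s)

eventually-map : ∀ {P Q : ℕ → Set} → (∀ {s} → P s → Q s) → Eventually P → Eventually Q
eventually-map f (N , p) = N , λ s N≤s → f (p s N≤s)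

eventually-witness : ∀ {P} → Eventually P → ∃ P
eventually-witness (N , p) = N , p N ℕₚ.≤-refl

-- A sequence tending to infinity takes a value below all its later values: start
-- anywhere and keep jumping to a later value that is no larger.
record-low : ExcludedMiddle 0ℓ → (l : ℕ → ℕ) → (∀ m → Eventually λ s → m ℕ.< l s) →
             ∀ S → ∃ λ t → S ℕ.≤ t × (∀ s → t ℕ.< s → l t ℕ.< l s)
record-low em l l→∞ S with l→∞ (l S)
... | N , h = go N S (ℕₚ.m≤n+m N S) h
  where
  go : ∀ r S → N ℕ.≤ S ℕ.+ r → (∀ s → N ℕ.≤ s → l S ℕ.< l s) →
       ∃ λ t → S ℕ.≤ t × (∀ s → t ℕ.< s → l t ℕ.< l s)
  go r S N≤ h with em {∃ λ s → S ℕ.< s × l s ℕ.≤ l S}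
  ... | no none = S , ℕₚ.≤-refl , λ s S<s → ℕₚ.≰⇒> λ ls≤lS → none (s , S<s , ls≤lS)
  -- `r` bounds the jumps still possible, since each moves `S` forward. At `r = 0` the start `S` has
  -- reached `N`, and every later value exceeds `l S`.
  go zero S N≤ h | yes (s , S<s , ls≤lS) = contradiction
    (h s (ℕₚ.≤-trans N≤ (ℕₚ.≤-trans (ℕₚ.≤-reflexive (ℕₚ.+-identityʳ S)) (ℕₚ.<⇒≤ S<s))))
    (ℕₚ.≤⇒≯ ls≤lS)
  go (suc r) S N≤ h | yes (s , S<s , ls≤lS)
    with go r s (ℕₚ.≤-trans N≤ (ℕₚ.≤-trans (ℕₚ.≤-reflexive (ℕₚ.+-suc S r)) (ℕₚ.+-monoˡ-≤ r S<s)))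
           (λ s′ N≤s′ → ℕₚ.≤-<-trans ls≤lS (h s′ N≤s′))
  ...   | t , s≤t , low = t , ℕₚ.≤-trans (ℕₚ.<⇒≤ S<s) s≤t , low

-- The least row that changes at a stage

module LeastChange (F : ℕ → ℕ → ℕ) where

  -- Zero exactly when F k changes at s or s ≤ k; the second case bounds the search.
  settled : ℕ → ℕ → ℕ
  settled k s = (1 ∸ distance (F k s) (F k (suc s))) ℕ.* (s ∸ k)

  abstract
    search : ∀ s → ∃ λ k → settled k s ≡ 0 × (∀ j → j ℕ.< k → settled j s ≢ 0)
    search s = leastZero (λ k → settled k s) s
      (trans (cong ((1 ∸ distance (F s s) (F s (suc s))) ℕ.*_) (ℕₚ.n∸n≡0 s))
        (ℕₚ.*-zeroʳ (1 ∸ distance (F s s) (F s (suc s)))))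

  level : ℕ → ℕ
  level s = proj₁ (search s)

  level-computable : Computable₂ F → Computable level
  level-computable F-comp = curried (μ-recursive _ settled-recursive
    (λ { (s ∷ []) → proj₁ (proj₂ (search s)) })
    (λ { (s ∷ []) → proj₂ (proj₂ (search s)) }))
    where
    F₀ = apply₂ F-comp (var 0F) (var 1F)
    F₁ = apply₂ F-comp (var 0F) (apply suc-computable (var 1F))
    settled-recursive : Recursive {2} (λ xs → settled (lookup xs 0F) (lookup xs 1F))
    settled-recursive = apply₂ *-computable
      (apply₂ ∸-computable (const-recursive 1)
        (apply₂ +-computable (apply₂ ∸-computable F₀ F₁) (apply₂ ∸-computable F₁ F₀)))
      (apply₂ ∸-computable (var 1F) (var 0F))

  -- Before its least zero `settled` is nonzero, so its first factor is nonzero too, which excludes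
  -- a positive distance.
  below-level : ∀ {j s} → j ℕ.< level s → F j s ≡ F j (suc s)
  below-level {j} {s} j<l with distance (F j s) (F j (suc s)) in eq
  ... | zero  = distance≡0⇒≡ _ _ eq
  ... | suc d = contradiction
    (cong (λ e → (1 ∸ e) ℕ.* (s ∸ j)) eq)
    (λ z → proj₂ (proj₂ (search s)) j j<l (trans z (cong (ℕ._* (s ∸ j)) (ℕₚ.0∸n≡0 d))))

  -- If `level s ≤ m`, its row does not change, so the zero of `settled` must come from
  -- `s ∸ level s`; this gives `s ≤ level s ≤ m`, against `m < s`.
  level-> : ∀ {m s} → m ℕ.< s → (∀ j → j ℕ.≤ m → F j s ≡ F j (suc s)) → m ℕ.< level s
  level-> {m} {s} m<s stable with m ℕₚ.<? level s
  ... | yes m<l = m<l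
  ... | no  m≮l = contradiction (proj₁ (proj₂ (search s))) λ eq →
    ℕₚ.<⇒≱ (ℕₚ.≤-<-trans l≤m m<s) (ℕₚ.m∸n≡0⇒m≤n (trans (sym unsettled) eq))
    where
    l = level s
    l≤m = ℕₚ.≮⇒≥ m≮l
    unsettled : settled l s ≡ s ∸ l
    unsettled rewrite sym (stable l l≤m) | distance-refl (F l s) = ℕₚ.+-identityʳ (s ∸ l)

  settles⇒level→∞ : (∀ k → ∃ λ c → Eventually λ s → F k s ≡ c) →
                    ∀ m → Eventually λ s → m ℕ.< level s
  settles⇒level→∞ settles m = eventually-map (λ (stable , m<s) → level-> m<s stable)
    (eventually-× (stable-up-to m) (suc m , λ _ m<s → m<s))
    where
    stable-at : ∀ k → Eventually λ s → F k s ≡ F k (suc s)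
    stable-at k with settles k
    ... | c , N , h = N , λ s N≤s → trans (h s N≤s) (sym (h (suc s) (ℕₚ.m≤n⇒m≤1+n N≤s)))
    stable-up-to : ∀ m → Eventually λ s → ∀ k → k ℕ.≤ m → F k s ≡ F k (suc s)
    stable-up-to zero = eventually-map (λ { h .0 z≤n → h }) (stable-at 0)
    stable-up-to (suc m) = eventually-map extend (eventually-× (stable-up-to m) (stable-at (suc m)))
      where
      extend : ∀ {s} → (∀ k → k ℕ.≤ m → F k s ≡ F k (suc s)) × F (suc m) s ≡ F (suc m) (suc s) →
               ∀ k → k ℕ.≤ suc m → F k s ≡ F k (suc s)
      extend (below , top) k k≤ with ℕₚ.m≤n⇒m<n∨m≡n k≤
      ... | inj₁ k<   = below k (ℕ.s≤s⁻¹ k<)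
      ... | inj₂ refl = top

  -- Row `k` lies below the level of every stage after `t`, so none of those stages changes it.
  -- Stage `t` itself may change it, hence the reference value at `suc t`.
  low-level⇒constant : ∀ {k t} → (∀ s → t ℕ.< s → k ℕ.< level s) →
                       ∀ {s} → t ℕ.< s → F k s ≡ F k (suc t)
  low-level⇒constant {k} {t} low {s} t<s =
    subst (λ i → F k i ≡ F k (suc t)) (ℕₚ.m∸n+n≡m t<s) (go (s ∸ suc t))
    where
    go : ∀ i → F k (i ℕ.+ suc t) ≡ F k (suc t)
    go zero    = refl
    go (suc i) = trans (sym (below-level (low (i ℕ.+ suc t) (ℕₚ.m≤n+m (suc t) i)))) (go i)

-- Parity and halving by primitive recursion

bit half : ℕ → ℕ
bit zero     = 0
bit (suc n)  = 1 ∸ bit n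
half zero    = 0
half (suc n) = half n ℕ.+ bit n

bit-computable : Computable bit
bit-computable = primRec _ (apply₂ ∸-computable (const-recursive 1) (var 1F)) (λ _ → refl)

half-computable : Computable half
half-computable = primRec _
  (apply₂ +-computable (var 1F) (apply bit-computable (var 0F))) (λ _ → refl)

bit-double : ∀ n → bit (n ℕ.+ n) ≡ 0
bit-double zero    = refl
bit-double (suc n) rewrite ℕₚ.+-suc n n | bit-double n = refl

half-double : ∀ n → half (n ℕ.+ n) ≡ n
half-double zero    = refl
half-double (suc n) rewrite ℕₚ.+-suc n n | bit-double n | half-double n | ℕₚ.+-identityʳ n =
  ℕₚ.+-comm n 1

bit-0-or-1 : ∀ n → bit n ≡ 0 ⊎ bit n ≡ 1
bit-0-or-1 zero    = inj₁ refl
bit-0-or-1 (suc n) with bit n | bit-0-or-1 n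
... | _ | inj₁ refl = inj₂ refl
... | _ | inj₂ refl = inj₁ refl

half-mono : ∀ {m n} → m ℕ.≤ n → half m ℕ.≤ half n
half-mono m≤n = go (ℕₚ.≤⇒≤′ m≤n)
  where
  go : ∀ {m n} → m ℕ.≤′ n → half m ℕ.≤ half n
  go ℕ.≤′-refl       = ℕₚ.≤-refl
  go (ℕ.≤′-step m≤n) = ℕₚ.≤-trans (go m≤n) (ℕₚ.m≤m+n _ _)

-- Rational arithmetic

move : ∀ p q r s → q ℚ.- p ≡ s ℚ.- r → q ℚ.+ (r ℚ.- p) ≡ s
move p q r s eq = trans (left p q r) (trans (cong (ℚ._+ r) eq) (right r s))
  where
  left : ∀ p q r → q ℚ.+ (r ℚ.- p) ≡ (q ℚ.- p) ℚ.+ r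
  left = solve 3 (λ p q r → q :+ (r :- p) := (q :- p) :+ r) refl
  right : ∀ r s → (s ℚ.- r) ℚ.+ r ≡ s
  right = solve 2 (λ r s → (s :- r) :+ r := s) refl

cancelled : ∀ p r → p ℚ.+ (r ℚ.- p) ≡ r
cancelled = solve 2 (λ p r → p :+ (r :- p) := r) refl

-- Linear arithmetic by certificate: known inequalities are added up, and the ring solver confirms
-- that the sum has the same slack as the goal.
≤-by-difference : ∀ {p q r s} → p ℚ.≤ q → q ℚ.- p ≡ s ℚ.- r → r ℚ.≤ s
≤-by-difference {p} {q} {r} {s} p≤q eq =
  subst₂ ℚ._≤_ (cancelled p r) (move p q r s eq) (ℚₚ.+-monoˡ-≤ (r ℚ.- p) p≤q)

<-by-difference : ∀ {p q r s} → p ℚ.< q → q ℚ.- p ≡ s ℚ.- r → r ℚ.< s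
<-by-difference {p} {q} {r} {s} p<q eq =
  subst₂ ℚ._<_ (cancelled p r) (move p q r s eq) (ℚₚ.+-monoˡ-< (r ℚ.- p) p<q)

infixl 6 _⊹_
_⊹_ : ∀ {p q r s} → p ℚ.≤ q → r ℚ.≤ s → p ℚ.+ r ℚ.≤ q ℚ.+ s
_⊹_ = ℚₚ.+-mono-≤

*-monoˡ-≤ : ∀ {p q r} → 0ℚ ℚ.≤ r → p ℚ.≤ q → r ℚ.* p ℚ.≤ r ℚ.* q
*-monoˡ-≤ {r = r} 0≤r = ℚₚ.*-monoˡ-≤-nonNeg r {{ℚ.nonNegative 0≤r}}

*-monoʳ-≤ : ∀ {p q r} → 0ℚ ℚ.≤ r → p ℚ.≤ q → p ℚ.* r ℚ.≤ q ℚ.* r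
*-monoʳ-≤ {r = r} 0≤r = ℚₚ.*-monoʳ-≤-nonNeg r {{ℚ.nonNegative 0≤r}}

*-monoʳ-< : ∀ {p q r} → 0ℚ ℚ.< r → p ℚ.< q → p ℚ.* r ℚ.< q ℚ.* r
*-monoʳ-< {r = r} 0<r = ℚₚ.*-monoˡ-<-pos r {{ℚ.positive 0<r}}

*-positive : ∀ {p q} → 0ℚ ℚ.< p → 0ℚ ℚ.< q → 0ℚ ℚ.< p ℚ.* q
*-positive {p} {q} 0<p 0<q = subst (ℚ._< p ℚ.* q) (ℚₚ.*-zeroˡ q) (*-monoʳ-< 0<q 0<p)

*-nonNegative : ∀ {p q} → 0ℚ ℚ.≤ p → 0ℚ ℚ.≤ q → 0ℚ ℚ.≤ p ℚ.* q
*-nonNegative {p} {q} 0≤p 0≤q = subst (ℚ._≤ p ℚ.* q) (ℚₚ.*-zeroˡ q) (*-monoʳ-≤ 0≤q 0≤p)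

0<½* : ∀ {p} → 0ℚ ℚ.< p → 0ℚ ℚ.< ½ ℚ.* p
0<½* = *-positive (ℚₚ.positive⁻¹ ½)

≤⇒∣∣≤ : ∀ {p e} → p ℚ.≤ e → ℚ.- p ℚ.≤ e → ℚ.∣ p ∣ ℚ.≤ e
≤⇒∣∣≤ {p} {e} p≤e -p≤e with ℚₚ.∣p∣≡p∨∣p∣≡-p p
... | inj₁ eq = subst (ℚ._≤ e) (sym eq) p≤e
... | inj₂ eq = subst (ℚ._≤ e) (sym eq) -p≤e

p≤∣p∣ : ∀ p → p ℚ.≤ ℚ.∣ p ∣
p≤∣p∣ p with ℚₚ.≤-total 0ℚ p
... | inj₁ 0≤p = ℚₚ.≤-reflexive (sym (ℚₚ.0≤p⇒∣p∣≡p 0≤p))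
... | inj₂ p≤0 = ℚₚ.≤-trans p≤0 (ℚₚ.0≤∣p∣ p)

-p≤∣p∣ : ∀ p → ℚ.- p ℚ.≤ ℚ.∣ p ∣
-p≤∣p∣ p = subst (ℚ.- p ℚ.≤_) (ℚₚ.∣-p∣≡∣p∣ p) (p≤∣p∣ (ℚ.- p))

fromℚᵘ-* : ∀ p q → fromℚᵘ p ℚ.* fromℚᵘ q ≡ fromℚᵘ (p ℚᵘ.* q)
fromℚᵘ-* p q = ℚₚ.toℚᵘ-injective (ℚᵘₚ.≃-trans (ℚₚ.toℚᵘ-homo-* (fromℚᵘ p) (fromℚᵘ q))
  (ℚᵘₚ.≃-trans (ℚᵘₚ.*-cong (ℚₚ.toℚᵘ-fromℚᵘ p) (ℚₚ.toℚᵘ-fromℚᵘ q))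
    (ℚᵘₚ.≃-sym (ℚₚ.toℚᵘ-fromℚᵘ (p ℚᵘ.* q)))))

fromℚᵘ-+ : ∀ p q → fromℚᵘ p ℚ.+ fromℚᵘ q ≡ fromℚᵘ (p ℚᵘ.+ q)
fromℚᵘ-+ p q = ℚₚ.toℚᵘ-injective (ℚᵘₚ.≃-trans (ℚₚ.toℚᵘ-homo-+ (fromℚᵘ p) (fromℚᵘ q))
  (ℚᵘₚ.≃-trans (ℚᵘₚ.+-cong (ℚₚ.toℚᵘ-fromℚᵘ p) (ℚₚ.toℚᵘ-fromℚᵘ q))
    (ℚᵘₚ.≃-sym (ℚₚ.toℚᵘ-fromℚᵘ (p ℚᵘ.+ q)))))

fromℚᵘ-mono-≤ : ∀ {p q} → p ℚᵘ.≤ q → fromℚᵘ p ℚ.≤ fromℚᵘ q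
fromℚᵘ-mono-≤ {p} {q} p≤q = ℚₚ.toℚᵘ-cancel-≤
  (ℚᵘₚ.≤-respˡ-≃ (ℚᵘₚ.≃-sym (ℚₚ.toℚᵘ-fromℚᵘ p)) (ℚᵘₚ.≤-respʳ-≃ (ℚᵘₚ.≃-sym (ℚₚ.toℚᵘ-fromℚᵘ q)) p≤q))

fromℚᵘ-mono-< : ∀ {p q} → p ℚᵘ.< q → fromℚᵘ p ℚ.< fromℚᵘ q
fromℚᵘ-mono-< {p} {q} p<q = ℚₚ.toℚᵘ-cancel-<
  (ℚᵘₚ.<-respˡ-≃ (ℚᵘₚ.≃-sym (ℚₚ.toℚᵘ-fromℚᵘ p)) (ℚᵘₚ.<-respʳ-≃ (ℚᵘₚ.≃-sym (ℚₚ.toℚᵘ-fromℚᵘ q)) p<q))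

-- Natural numbers and the fractions `1/(k+1)` as rationals. They are opaque, so what follows rests
-- on the laws of this block and not on unfolding normalised fractions.
abstract
  ι : ℕ → ℚ
  ι n = fromℚᵘ (mkℚᵘ (+ n) 0)

  unit : ℕ → ℚ
  unit k = fromℚᵘ (mkℚᵘ (+ 1) k)

  ι-* : ∀ m n → ι (m ℕ.* n) ≡ ι m ℚ.* ι n
  ι-* m n = sym (trans (fromℚᵘ-* (mkℚᵘ (+ m) 0) (mkℚᵘ (+ n) 0))
    (ℚₚ.fromℚᵘ-cong {mkℚᵘ (+ m) 0 ℚᵘ.* mkℚᵘ (+ n) 0} {mkℚᵘ (+ (m ℕ.* n)) 0}
      (*≡* (cong (ℤ._* + 1) (sym (ℤₚ.pos-* m n))))))

  ι-suc : ∀ n → ι (suc n) ≡ 1ℚ ℚ.+ ι n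
  ι-suc n = sym (trans (fromℚᵘ-+ (mkℚᵘ (+ 1) 0) (mkℚᵘ (+ n) 0))
    (ℚₚ.fromℚᵘ-cong {mkℚᵘ (+ 1) 0 ℚᵘ.+ mkℚᵘ (+ n) 0} {mkℚᵘ (+ suc n) 0}
      (*≡* (cong (λ i → (+ 1 ℤ.+ i) ℤ.* + 1) (ℤₚ.*-identityʳ (+ n))))))

  0≤ι : ∀ n → 0ℚ ℚ.≤ ι n
  0≤ι n = fromℚᵘ-mono-≤ {mkℚᵘ (+ 0) 0} {mkℚᵘ (+ n) 0}
    (*≤* (ℤₚ.*-monoʳ-≤-nonNeg (+ 1) {+ 0} {+ n} (ℤ.+≤+ z≤n)))

  ι-mono-≤ : ∀ {m n} → m ℕ.≤ n → ι m ℚ.≤ ι n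
  ι-mono-≤ {m} {n} m≤n = fromℚᵘ-mono-≤ {mkℚᵘ (+ m) 0} {mkℚᵘ (+ n) 0}
    (*≤* (ℤₚ.*-monoʳ-≤-nonNeg (+ 1) (ℤ.+≤+ m≤n)))

  ι-mono-< : ∀ {m n} → m ℕ.< n → ι m ℚ.< ι n
  ι-mono-< {m} {n} m<n = fromℚᵘ-mono-< {mkℚᵘ (+ m) 0} {mkℚᵘ (+ n) 0}
    (*<* (ℤₚ.*-monoʳ-<-pos (+ 1) (ℤ.+<+ m<n)))

  ι-cancel-< : ∀ {m n} → ι m ℚ.< ι n → m ℕ.< n
  ι-cancel-< {m} {n} ιm<ιn with m ℕₚ.<? n
  ... | yes m<n = m<n
  ... | no  m≮n = contradiction (ℚₚ.<-≤-trans ιm<ιn (ι-mono-≤ (ℕₚ.≮⇒≥ m≮n))) (ℚₚ.<-irrefl refl)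

  /≡ι*unit : ∀ n d → (+ n) ℚ./ suc d ≡ ι n ℚ.* unit d
  /≡ι*unit n d = sym (trans (fromℚᵘ-* (mkℚᵘ (+ n) 0) (mkℚᵘ (+ 1) d))
    (ℚₚ.fromℚᵘ-cong {mkℚᵘ (+ n) 0 ℚᵘ.* mkℚᵘ (+ 1) d} {mkℚᵘ (+ n) d}
      (*≡* (cong₂ ℤ._*_ (ℤₚ.*-identityʳ (+ n)) (sym (ℤₚ.*-identityˡ (+ suc d)))))))

  -- The index on the right is `suc d * suc k` less one, in the form to which the product of the
  -- denominators reduces.
  unit-* : ∀ d k → unit d ℚ.* unit k ≡ unit (k ℕ.+ d ℕ.* suc k)
  unit-* d k = fromℚᵘ-* (mkℚᵘ (+ 1) d) (mkℚᵘ (+ 1) k)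

  ι-suc*unit : ∀ k → ι (suc k) ℚ.* unit k ≡ 1ℚ
  ι-suc*unit k = trans (sym (/≡ι*unit (suc k) k))
    (ℚₚ.fromℚᵘ-cong {mkℚᵘ (+ suc k) k} {mkℚᵘ (+ 1) 0} (*≡* (ℤₚ.*-comm (+ suc k) (+ 1))))

  0<unit : ∀ k → 0ℚ ℚ.< unit k
  0<unit k = fromℚᵘ-mono-< {mkℚᵘ (+ 0) 0} {mkℚᵘ (+ 1) k} (*<* (ℤ.+<+ (s≤s z≤n)))

  0≤unit : ∀ k → 0ℚ ℚ.≤ unit k
  0≤unit k = ℚₚ.<⇒≤ (0<unit k)

  unit-anti : ∀ {k m} → k ℕ.≤ m → unit m ℚ.≤ unit k
  unit-anti {k} {m} k≤m = fromℚᵘ-mono-≤ {mkℚᵘ (+ 1) m} {mkℚᵘ (+ 1) k}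
    (*≤* (ℤₚ.*-monoˡ-≤-nonNeg (+ 1) (ℤ.+≤+ (s≤s k≤m))))

  archimedean : ∀ δ → 0ℚ ℚ.< δ → ∃ λ j → ∀ k → j ℕ.≤ k → unit k ℚ.≤ δ
  -- A positive fraction `(n+1)/(d+1)` is at least `1/(d+1)`, so its own denominator supplies the
  -- bound.
  archimedean δ@(mkℚ (+ suc n) d c) 0<δ = d , λ k d≤k → ℚₚ.≤-trans (unit-anti d≤k)
    (subst (unit d ℚ.≤_) (ℚₚ.fromℚᵘ-toℚᵘ δ)
      (fromℚᵘ-mono-≤ {mkℚᵘ (+ 1) d} {mkℚᵘ (+ suc n) d}
        (*≤* (ℤₚ.*-monoʳ-≤-nonNeg (+ suc d) {+ 1} {+ suc n} (ℤ.+≤+ (s≤s z≤n))))))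
  archimedean (mkℚ (+ zero) d c)   (ℚ.*<* (ℤ.+<+ ()))
  archimedean (mkℚ ℤ.-[1+ n ] d c) (ℚ.*<* ())

-- Nonnegativity of the fraction forces `n ≤ p`, so truncated subtraction loses nothing and the
-- numerator becomes a natural number, ready for integer division.
truncate : ∀ p n d → 0ℚ ℚ.≤ (p ⊖ n) ℚ./ suc d → (p ⊖ n) ℚ./ suc d ≡ ι (p ∸ n) ℚ.* unit d
truncate p n d 0≤q = trans (cong (ℚ._/ suc d) (ℤₚ.⊖-≥ n≤p)) (/≡ι*unit (p ∸ n) d)
  where
  0≤ᵘ : mkℚᵘ (+ 0) 0 ℚᵘ.≤ mkℚᵘ (p ⊖ n) d
  0≤ᵘ = ℚᵘₚ.≤-respʳ-≃ (ℚₚ.toℚᵘ-fromℚᵘ (mkℚᵘ (p ⊖ n) d)) (ℚₚ.toℚᵘ-mono-≤ 0≤q)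
  0≤⊖ : ℤ.0ℤ ℤ.≤ p ⊖ n
  0≤⊖ with *≤* le ← 0≤ᵘ = subst (ℤ.0ℤ ℤ.≤_) (ℤₚ.*-identityʳ (p ⊖ n)) le
  n≤p : n ℕ.≤ p
  n≤p = ℤₚ.drop‿+≤+ (ℤₚ.0≤i-j⇒j≤i (subst (ℤ.0ℤ ℤ.≤_) (sym (ℤₚ.m-n≡m⊖n p n)) 0≤⊖))

-- Convergence and lower limits

-- Distance to `α` is measured on a tail of its Cauchy sequence, which reduces estimates about reals
-- to rational ones.
Close : ℝ → ℚ → ℚ → Set
Close α ε q = Eventually λ n → ℚ.∣ q ℚ.- seq α n ∣ ℚ.≤ ε

Converges : (ℕ → ℚ) → ℝ → Set
Converges a α = ∀ ε → 0ℚ ℚ.< ε → Eventually λ s → Close α ε (a s)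

⟶⇒Converges : ∀ {a α} → a ⟶ α → Converges a α
⟶⇒Converges {a} {α} a⟶α ε 0<ε = eventually-map
  (λ {s} (δ , 0<δ , close) → eventually-map (λ {n} le →
    ≤-by-difference (ℚₚ.<⇒≤ 0<δ ⊹ le) (eq δ ℚ.∣ a s ℚ.- seq α n ∣ ε)) close)
  (a⟶α (fromℚ ε) (ε , 0<ε , 0 , λ _ _ → ℚₚ.≤-reflexive (ℚₚ.+-identityˡ ε)))
  where
  eq : ∀ δ t ε → (δ ℚ.+ ε) ℚ.- (0ℚ ℚ.+ (t ℚ.+ δ)) ≡ ε ℚ.- t
  eq = solve 3 (λ δ t ε → (δ :+ ε) :- (con 0ℚ :+ (t :+ δ)) := ε :- t) refl

-- Half of the gap `δ` between `0ℝ` and `ε` bounds the error; the other half remains as the gap that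
-- strict inequality demands.
Converges⇒⟶ : ∀ {a α} → Converges a α → a ⟶ α
Converges⇒⟶ {a} {α} conv ε (δ , 0<δ , δ≤ε) = eventually-map
  (λ {s} close → ½ ℚ.* δ , 0<½* 0<δ , eventually-map
    (λ {n} (δ≤εₙ , le) → ≤-by-difference (δ≤εₙ ⊹ le)
      (eq δ ℚ.∣ a s ℚ.- seq α n ∣ (seq ε n))) (eventually-× δ≤ε close))
  (conv (½ ℚ.* δ) (0<½* 0<δ))
  where
  eq : ∀ δ t e → (e ℚ.+ ½ ℚ.* δ) ℚ.- ((0ℚ ℚ.+ δ) ℚ.+ t) ≡ e ℚ.- (t ℚ.+ ½ ℚ.* δ)
  eq = solve 3 (λ δ t e → (e :+ con ½ :* δ) :- ((con 0ℚ :+ δ) :+ t) := e :- (t :+ con ½ :* δ)) refl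

∣p-q∣≤e⇒p-q≤e : ∀ {p q e} → ℚ.∣ p ℚ.- q ∣ ℚ.≤ e → p ℚ.- q ℚ.≤ e
∣p-q∣≤e⇒p-q≤e {p} {q} = ℚₚ.≤-trans (p≤∣p∣ (p ℚ.- q))

neg-sub : ∀ p q → ℚ.- (p ℚ.- q) ≡ q ℚ.- p
neg-sub = solve 2 (λ p q → :- (p :- q) := q :- p) refl

∣p-q∣≤e⇒q-p≤e : ∀ {p q e} → ℚ.∣ p ℚ.- q ∣ ℚ.≤ e → q ℚ.- p ℚ.≤ e
∣p-q∣≤e⇒q-p≤e {p} {q} {e} le =
  subst (ℚ._≤ e) (neg-sub p q) (ℚₚ.≤-trans (-p≤∣p∣ (p ℚ.- q)) le)

p-q≤e⇒∣p-q∣≤e : ∀ {p q e} → p ℚ.- q ℚ.≤ e → q ℚ.- p ℚ.≤ e → ℚ.∣ p ℚ.- q ∣ ℚ.≤ e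
p-q≤e⇒∣p-q∣≤e {p} {q} {e} le ge = ≤⇒∣∣≤ le (subst (ℚ._≤ e) (sym (neg-sub p q)) ge)

-- The case `q ≡ 0ℚ` is covered because `recip 0ℚ` is `0ℚ`, so a ratio can be bounded term by term
-- with no lower bound on its denominators.
∣÷∣-bound : ∀ p q η → 0ℚ ℚ.≤ η → ℚ.∣ p ∣ ℚ.≤ η ℚ.* ℚ.∣ q ∣ → ℚ.∣ p ℚ.* recip q ∣ ℚ.≤ η
∣÷∣-bound p q η 0≤η le with q ℚₚ.≟ 0ℚ
... | yes refl = subst (ℚ._≤ η) (cong ℚ.∣_∣ (sym (ℚₚ.*-zeroʳ p))) 0≤η
... | no  q≢0  = begin
  ℚ.∣ p ℚ.* r ∣                    ≡⟨ ℚₚ.∣p*q∣≡∣p∣*∣q∣ p r ⟩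
  ℚ.∣ p ∣ ℚ.* ℚ.∣ r ∣              ≤⟨ *-monoʳ-≤ (ℚₚ.0≤∣p∣ r) le ⟩
  η ℚ.* ℚ.∣ q ∣ ℚ.* ℚ.∣ r ∣        ≡⟨ ℚₚ.*-assoc η ℚ.∣ q ∣ ℚ.∣ r ∣ ⟩
  η ℚ.* (ℚ.∣ q ∣ ℚ.* ℚ.∣ r ∣)      ≡⟨ cong (η ℚ.*_) (sym (ℚₚ.∣p*q∣≡∣p∣*∣q∣ q r)) ⟩
  η ℚ.* ℚ.∣ q ℚ.* r ∣              ≡⟨ cong (λ t → η ℚ.* ℚ.∣ t ∣) (ℚₚ.*-inverseʳ q {{ℚ.≢-nonZero q≢0}}) ⟩
  η ℚ.* 1ℚ                         ≡⟨ ℚₚ.*-identityʳ η ⟩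
  η                                ∎
  where
  open ℚₚ.≤-Reasoning
  r = (ℚ.1/ q) {{ℚ.≢-nonZero q≢0}}

-- Every tail has infimum 0: the terms are nonnegative and arbitrarily late ones are arbitrarily
-- small. The sequence of infima is thus constantly `0ℝ`, and so is its supremum.
liminf-≤0 : (r : ℕ → ℝ) → (∀ s n → 0ℚ ℚ.≤ seq (r s) n) →
  (∀ η → 0ℚ ℚ.< η → ∀ S → ∃ λ s → S ℕ.≤ s × Eventually λ n → seq (r s) n ℚ.≤ η) →
  Liminf r ≤ 0ℝ
liminf-≤0 r 0≤r small =
  0ℝ , ((λ _ → 0ℝ) , (λ S → (λ k → lower (S ℕ.+ k)) , greatest S) ,
        (λ _ → 0≮0) , λ _ h → h 0) , 0≮0
  where
  0≮0 : ¬ (0ℝ < 0ℝ)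
  0≮0 (ε , 0<ε , N , h) = ℚₚ.<-irrefl refl
    (ℚₚ.<-≤-trans (ℚₚ.+-mono-≤-< (ℚₚ.≤-refl {0ℚ}) 0<ε) (h N ℕₚ.≤-refl))
  lower : ∀ s → ¬ (r s < 0ℝ)
  lower s (ε , 0<ε , N , h) = ℚₚ.<-irrefl refl
    (ℚₚ.<-≤-trans (ℚₚ.+-mono-≤-< (0≤r s N) 0<ε) (h N ℕₚ.≤-refl))
  eq : ∀ ε t e → (½ ℚ.* ε ℚ.+ e) ℚ.- (t ℚ.+ (0ℚ ℚ.+ ε)) ≡ e ℚ.- (t ℚ.+ ½ ℚ.* ε)
  eq = solve 3 (λ ε t e →
    (con ½ :* ε :+ e) :- (t :+ (con 0ℚ :+ ε)) := e :- (t :+ con ½ :* ε)) refl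
  greatest : ∀ S j → (∀ k → j ≤ r (S ℕ.+ k)) → ¬ (0ℝ < j)
  -- A lower bound `j` with gap `ε` above 0 is refuted by a term of size at most half of `ε`: it
  -- lies below `j` with the other half to spare.
  greatest S j j≤ (ε , 0<ε , ε≤j) with small (½ ℚ.* ε) (0<½* 0<ε) S
  ... | s , S≤s , rs≤ = j≤ (s ∸ S) (subst (λ i → r i < j) (sym (ℕₚ.m+[n∸m]≡n S≤s))
    (½ ℚ.* ε , 0<½* 0<ε , eventually-map
      (λ {n} (le , ge) → ≤-by-difference (le ⊹ ge) (eq ε (seq (r s) n) (seq j n)))
      (eventually-× rs≤ ε≤j)))

-- The width of grid `k` is the square of the detour factor `unit k`, so that an error of a few
-- cells is negligible against the detour as `k` grows.
cell : ℕ → ℚ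
cell k = unit k ℚ.* unit k

0<cell : ∀ k → 0ℚ ℚ.< cell k
0<cell k = *-positive (0<unit k) (0<unit k)

-- The points `p` and `q` share the cell from `f * v` to `(1 + f) * v`, so they differ by at most
-- `v`; passing from `q` to `r` costs another `v`.
common-cell : ∀ f v p q r →
  f ℚ.* v ℚ.≤ p → p ℚ.≤ (1ℚ ℚ.+ f) ℚ.* v → f ℚ.* v ℚ.≤ q → q ℚ.≤ (1ℚ ℚ.+ f) ℚ.* v →
  ℚ.∣ q ℚ.- r ∣ ℚ.≤ v → ℚ.∣ p ℚ.- r ∣ ℚ.≤ v ℚ.+ v
common-cell f v p q r f≤p p≤f+1 f≤q q≤f+1 q≈r = p-q≤e⇒∣p-q∣≤e {p} {r}
  (≤-by-difference (∣p-q∣≤e⇒p-q≤e {q} {r} q≈r ⊹ (p≤f+1 ⊹ f≤q)) (eq₁ f v p q r))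
  (≤-by-difference (∣p-q∣≤e⇒q-p≤e {q} {r} q≈r ⊹ (q≤f+1 ⊹ f≤p)) (eq₂ f v p q r))
  where
  eq₁ : ∀ f v p q r →
    (v ℚ.+ ((1ℚ ℚ.+ f) ℚ.* v ℚ.+ q)) ℚ.- ((q ℚ.- r) ℚ.+ (p ℚ.+ f ℚ.* v)) ≡ (v ℚ.+ v) ℚ.- (p ℚ.- r)
  eq₁ = solve 5 (λ f v p q r →
    (v :+ ((con 1ℚ :+ f) :* v :+ q)) :- ((q :- r) :+ (p :+ f :* v)) := (v :+ v) :- (p :- r)) refl
  eq₂ : ∀ f v p q r →
    (v ℚ.+ ((1ℚ ℚ.+ f) ℚ.* v ℚ.+ p)) ℚ.- ((r ℚ.- q) ℚ.+ (q ℚ.+ f ℚ.* v)) ≡ (v ℚ.+ v) ℚ.- (r ℚ.- p)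
  eq₂ = solve 5 (λ f v p q r →
    (v :+ ((con 1ℚ :+ f) :* v :+ p)) :- ((r :- q) :+ (q :+ f :* v)) := (v :+ v) :- (r :- p)) refl

-- The sped-up approximation

module Construction
  (em : ExcludedMiddle 0ℓ) (α : ℝ) (0<α : 0ℝ < α) (irr : Irrational α)
  (x d : ℕ → ℕ) (a : ℕ → ℚ) (a≡ : ∀ s → a s ≡ ι (x s) ℚ.* unit (d s))
  (0≤a : ∀ s → 0ℚ ℚ.≤ a s) (a≤1 : ∀ s → a s ℚ.≤ 1ℚ) (conv : Converges a α)
  where

  -- Rounding down to a grid

  private
    -- Multiplying the integer inequalities that characterise the quotient by `unit e * cell k`
    -- turns them into rational bounds on `a s`; this lemma and `scaled-value` evaluate the two
    -- sides.
    scaled-floor : ∀ k q e → ι (q ℕ.* suc e) ℚ.* (unit e ℚ.* cell k) ≡ ι q ℚ.* cell k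
    scaled-floor k q e = trans (cong (ℚ._* (unit e ℚ.* cell k)) (ι-* q (suc e)))
      (trans (regroup (ι q) (ι (suc e)) (unit e) (cell k))
        (trans (cong (ℚ._* (ι q ℚ.* cell k)) (ι-suc*unit e)) (ℚₚ.*-identityˡ _)))
      where
      regroup : ∀ q e r v → (q ℚ.* e) ℚ.* (r ℚ.* v) ≡ (e ℚ.* r) ℚ.* (q ℚ.* v)
      regroup = solve 4 (λ q e r v → (q :* e) :* (r :* v) := (e :* r) :* (q :* v)) refl

    ι-square : ∀ k → ι (suc k ℕ.* suc k) ℚ.* cell k ≡ 1ℚ
    ι-square k = trans (cong (ℚ._* cell k) (ι-* (suc k) (suc k)))
      (trans (regroup (ι (suc k)) (unit k)) (cong₂ ℚ._*_ (ι-suc*unit k) (ι-suc*unit k)))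
      where
      regroup : ∀ m u → (m ℚ.* m) ℚ.* (u ℚ.* u) ≡ (m ℚ.* u) ℚ.* (m ℚ.* u)
      regroup = solve 2 (λ m u → (m :* m) :* (u :* u) := (m :* u) :* (m :* u)) refl

    scaled-value : ∀ k s →
      ι (suc k ℕ.* suc k ℕ.* x s) ℚ.* (unit (d s) ℚ.* cell k) ≡ a s
    scaled-value k s = trans (cong (ℚ._* (unit (d s) ℚ.* cell k)) (ι-* (suc k ℕ.* suc k) (x s)))
      (trans (regroup (ι (suc k ℕ.* suc k)) (ι (x s)) (unit (d s)) (cell k))
        (trans (cong (ℚ._* (ι (x s) ℚ.* unit (d s))) (ι-square k))
          (trans (ℚₚ.*-identityˡ _) (sym (a≡ s)))))
      where
      regroup : ∀ m q e v → (m ℚ.* q) ℚ.* (e ℚ.* v) ≡ (m ℚ.* v) ℚ.* (q ℚ.* e)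
      regroup = solve 4 (λ m q e v → (m :* q) :* (e :* v) := (m :* v) :* (q :* e)) refl

  abstract
    gridFloor : ℕ → ℕ → ℕ
    gridFloor k s = (suc k ℕ.* suc k ℕ.* x s) / suc (d s)

    gridFloor-computable : Computable x → Computable d → Computable₂ gridFloor
    gridFloor-computable x-comp d-comp = curried₂ (apply₂ /-computable
      (apply₂ *-computable (apply₂ *-computable k+1 k+1) (apply x-comp (var 1F)))
      (apply d-comp (var 1F)))
      where
      k+1 : Recursive {2} (λ ks → suc (lookup ks 0F))
      k+1 = apply suc-computable (var 0F)

    gridFloor-≤ : ∀ k s → ι (gridFloor k s) ℚ.* cell k ℚ.≤ a s
    gridFloor-≤ k s = subst₂ ℚ._≤_ (scaled-floor k (gridFloor k s) (d s)) (scaled-value k s)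
      (*-monoʳ-≤ (ℚₚ.<⇒≤ (*-positive (0<unit (d s)) (0<cell k)))
        (ι-mono-≤ (ℕ.m/n*n≤m (suc k ℕ.* suc k ℕ.* x s) (suc (d s)))))

    gridFloor-> : ∀ k s → a s ℚ.< ι (suc (gridFloor k s)) ℚ.* cell k
    gridFloor-> k s = subst₂ ℚ._<_ (scaled-value k s) (scaled-floor k (suc (gridFloor k s)) (d s))
      (*-monoʳ-< (*-positive (0<unit (d s)) (0<cell k))
        (ι-mono-< (m<[1+m/n]*n (suc k ℕ.* suc k ℕ.* x s) (d s))))

  -- Being irrational, `α` is apart from `q`. Once the error of `a s` is at most half of the gap,
  -- `a s` is on the same side of `q` as `α`.
  separated : ∀ q → Eventually (λ s → q ℚ.< a s) ⊎ Eventually (λ s → a s ℚ.< q)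
  separated q with decidable-stable (em {α # fromℚ q}) (λ α≃q → irr (q , α≃q))
  ... | inj₁ (ε , 0<ε , α<q) = inj₂ (eventually-map below (conv (½ ℚ.* ε) (0<½* 0<ε)))
    where
    eq : ∀ ε q t α → (½ ℚ.* ε ℚ.+ (½ ℚ.* ε ℚ.+ q)) ℚ.- (0ℚ ℚ.+ ((t ℚ.- α) ℚ.+ (α ℚ.+ ε))) ≡ q ℚ.- t
    eq = solve 4 (λ ε q t α →
      (con ½ :* ε :+ (con ½ :* ε :+ q)) :- (con 0ℚ :+ ((t :- α) :+ (α :+ ε))) := q :- t) refl
    below : ∀ {s} → Close α (½ ℚ.* ε) (a s) → a s ℚ.< q
    below {s} close with eventually-witness (eventually-× close α<q)
    ... | n , le , α+ε≤q = <-by-difference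
      (ℚₚ.+-mono-<-≤ (0<½* 0<ε) (∣p-q∣≤e⇒p-q≤e {a s} {seq α n} le ⊹ α+ε≤q)) (eq ε q (a s) (seq α n))
  ... | inj₂ (ε , 0<ε , q<α) = inj₁ (eventually-map above (conv (½ ℚ.* ε) (0<½* 0<ε)))
    where
    eq : ∀ ε q t α → (½ ℚ.* ε ℚ.+ (½ ℚ.* ε ℚ.+ α)) ℚ.- (0ℚ ℚ.+ ((α ℚ.- t) ℚ.+ (q ℚ.+ ε))) ≡ t ℚ.- q
    eq = solve 4 (λ ε q t α →
      (con ½ :* ε :+ (con ½ :* ε :+ α)) :- (con 0ℚ :+ ((α :- t) :+ (q :+ ε))) := t :- q) refl
    above : ∀ {s} → Close α (½ ℚ.* ε) (a s) → q ℚ.< a s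
    above {s} close with eventually-witness (eventually-× close q<α)
    ... | n , le , q+ε≤α = <-by-difference
      (ℚₚ.+-mono-<-≤ (0<½* 0<ε) (∣p-q∣≤e⇒q-p≤e {a s} {seq α n} le ⊹ q+ε≤α)) (eq ε q (a s) (seq α n))

  private
    cell-cancel-< : ∀ k {m n} → ι m ℚ.* cell k ℚ.< ι n ℚ.* cell k → m ℕ.< n
    cell-cancel-< k {m} {n} lt = ι-cancel-< {m} {n}
      (ℚₚ.*-cancelʳ-<-nonNeg (cell k) {{ℚ.nonNegative (ℚₚ.<⇒≤ (0<cell k))}} lt)

  gridFloor-< : ∀ k n {s} → a s ℚ.< ι n ℚ.* cell k → gridFloor k s ℕ.< n
  gridFloor-< k n {s} lt = cell-cancel-< k {gridFloor k s} {n} (ℚₚ.≤-<-trans (gridFloor-≤ k s) lt)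

  <-gridFloor : ∀ k n {s} → ι n ℚ.* cell k ℚ.< a s → n ℕ.≤ gridFloor k s
  <-gridFloor k n {s} lt =
    ℕ.s≤s⁻¹ (cell-cancel-< k {n} {suc (gridFloor k s)} (ℚₚ.<-trans lt (gridFloor-> k s)))

  -- A descent through the grid points: `separated` tells on which side of each one `a s` finally
  -- stays, and the first point found below `a s` is the limit of the floors; if there is none, the
  -- limit is 0.
  gridFloor-settles : ∀ k → ∃ λ c → Eventually λ s → gridFloor k s ≡ c
  gridFloor-settles k = descend (suc k ℕ.* suc k)
    -- The grid point `suc k * suc k` equals 1, which `a s` may attain; the strict bound therefore
    -- starts one cell higher.
    (0 , λ s _ → ℚₚ.≤-<-trans (a≤1 s) (subst (ℚ._< ι (suc (suc k ℕ.* suc k)) ℚ.* cell k)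
      (ι-square k) (*-monoʳ-< (0<cell k) (ι-mono-< (ℕₚ.n<1+n (suc k ℕ.* suc k))))))
    where
    descend : ∀ j → Eventually (λ s → a s ℚ.< ι (suc j) ℚ.* cell k) →
              ∃ λ c → Eventually λ s → gridFloor k s ≡ c
    descend zero below =
      0 , eventually-map (λ lt → ℕₚ.n<1⇒n≡0 (gridFloor-< k 1 lt)) below
    descend (suc j) below with separated (ι (suc j) ℚ.* cell k)
    ... | inj₁ above = suc j , eventually-map
      (λ (lt , gt) → ℕₚ.≤-antisym (ℕ.s≤s⁻¹ (gridFloor-< k (suc (suc j)) lt)) (<-gridFloor k (suc j) gt))
      (eventually-× below above)
    ... | inj₂ below′ = descend j below′

  -- Levels and stages of lowest level

  open LeastChange gridFloor

  level→∞ : ∀ m → Eventually λ s → m ℕ.< level s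
  level→∞ = settles⇒level→∞ gridFloor-settles

  -- From `suc t` on the floor in grid `level t` is constant, so `a (suc t)` shares its cell with
  -- every later term, and a sufficiently late term is within one cell width of `α`.
  confined : ∀ t → (∀ s → t ℕ.< s → level t ℕ.< level s) →
             Close α (cell (level t) ℚ.+ cell (level t)) (a (suc t))
  confined t low = close
    where
    k = level t
    constant : ∀ {s} → suc t ℕ.≤ s → gridFloor k s ≡ gridFloor k (suc t)
    constant = low-level⇒constant {k} {t} low
    lower : ∀ {s} → suc t ℕ.≤ s → ι (gridFloor k (suc t)) ℚ.* cell k ℚ.≤ a s
    lower {s} t<s = subst (λ f → ι f ℚ.* cell k ℚ.≤ a s) (constant t<s) (gridFloor-≤ k s)
    upper : ∀ {s} → suc t ℕ.≤ s → a s ℚ.≤ (1ℚ ℚ.+ ι (gridFloor k (suc t))) ℚ.* cell k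
    upper {s} t<s = subst (λ f → a s ℚ.≤ f ℚ.* cell k) (ι-suc (gridFloor k (suc t)))
      (subst (λ f → a s ℚ.≤ ι (suc f) ℚ.* cell k) (constant t<s) (ℚₚ.<⇒≤ (gridFloor-> k s)))
    close : Close α (cell k ℚ.+ cell k) (a (suc t))
    close with eventually-witness (eventually-× (conv (cell k) (0<cell k)) (suc t , λ _ t<s → t<s))
    ... | s , closeₛ , t<s = eventually-map
      (λ {n} → common-cell (ι (gridFloor k (suc t))) (cell k) (a (suc t)) (a s) (seq α n)
        (lower ℕₚ.≤-refl) (upper ℕₚ.≤-refl) (lower t<s) (upper t<s)) closeₛ

  settled-stage : ∀ S → ∃ λ t → S ℕ.≤ t ×
    Close α (cell (level t) ℚ.+ cell (level t)) (a (suc t))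
  settled-stage S = let t , S≤t , low = record-low em level level→∞ S in t , S≤t , confined t low

  -- k / (k + 1) at even t and 1 at odd t, where k = level (half t).
  weight : ℕ → ℚ
  weight t = ι (level (half t) ℕ.+ bit t) ℚ.* unit (level (half t))

  b : ℕ → ℚ
  b t = a (suc (half t)) ℚ.* weight t

  private
    ι*unit : ∀ k → ι k ℚ.* unit k ≡ 1ℚ ℚ.- unit k
    ι*unit k = trans (split (ι k) (unit k))
      (cong (ℚ._- unit k) (trans (cong (ℚ._* unit k) (sym (ι-suc k))) (ι-suc*unit k)))
      where
      split : ∀ n u → n ℚ.* u ≡ (1ℚ ℚ.+ n) ℚ.* u ℚ.- u
      split = solve 2 (λ n u → n :* u := (con 1ℚ :+ n) :* u :- u) refl

  weight-even : ∀ t → bit t ≡ 0 → weight t ≡ 1ℚ ℚ.- unit (level (half t))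
  weight-even t even rewrite even | ℕₚ.+-identityʳ (level (half t)) = ι*unit (level (half t))

  weight-odd : ∀ t → bit t ≡ 1 → weight t ≡ 1ℚ
  weight-odd t odd rewrite odd | ℕₚ.+-comm (level (half t)) 1 = ι-suc*unit (level (half t))

  0≤weight : ∀ t → 0ℚ ℚ.≤ weight t
  0≤weight t = *-nonNegative (0≤ι (level (half t) ℕ.+ bit t)) (0≤unit (level (half t)))

  private
    1-u≤1 : ∀ u → 0ℚ ℚ.≤ u → 1ℚ ℚ.- u ℚ.≤ 1ℚ
    1-u≤1 u 0≤u = ≤-by-difference 0≤u (eq u)
      where
      eq : ∀ u → u ℚ.- 0ℚ ≡ 1ℚ ℚ.- (1ℚ ℚ.- u)
      eq = solve 1 (λ u → u :- con 0ℚ := con 1ℚ :- (con 1ℚ :- u)) refl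

  weight≤1 : ∀ t → weight t ℚ.≤ 1ℚ
  weight≤1 t with bit-0-or-1 t
  ... | inj₁ even = subst (ℚ._≤ 1ℚ) (sym (weight-even t even)) (1-u≤1 _ (0≤unit (level (half t))))
  ... | inj₂ odd  = ℚₚ.≤-reflexive (weight-odd t odd)

  1-unit≤weight : ∀ t → 1ℚ ℚ.- unit (level (half t)) ℚ.≤ weight t
  1-unit≤weight t with bit-0-or-1 t
  ... | inj₁ even = ℚₚ.≤-reflexive (sym (weight-even t even))
  ... | inj₂ odd  = subst (1ℚ ℚ.- unit (level (half t)) ℚ.≤_) (sym (weight-odd t odd))
    (1-u≤1 _ (0≤unit (level (half t))))

  b≤a : ∀ t → b t ℚ.≤ a (suc (half t))
  b≤a t = subst (b t ℚ.≤_) (ℚₚ.*-identityʳ (a (suc (half t))))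
    (*-monoˡ-≤ (0≤a (suc (half t))) (weight≤1 t))

  -- As `a ≤ 1`, removing the fraction `unit` of the value costs at most `unit`. With levels tending
  -- to infinity the detours therefore vanish in the limit.
  a-unit≤b : ∀ t → a (suc (half t)) ℚ.- unit (level (half t)) ℚ.≤ b t
  a-unit≤b t = ≤-by-difference
    (*-monoˡ-≤ (0≤a (suc (half t))) (1-unit≤weight t)
      ⊹ *-monoʳ-≤ (0≤unit (level (half t))) (a≤1 (suc (half t))))
    (eq (a (suc (half t))) (unit (level (half t))) (b t))
    where
    eq : ∀ p u q → (q ℚ.+ 1ℚ ℚ.* u) ℚ.- (p ℚ.* (1ℚ ℚ.- u) ℚ.+ p ℚ.* u) ≡ q ℚ.- (p ℚ.- u)
    eq = solve 3 (λ p u q →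
      (q :+ con 1ℚ :* u) :- (p :* (con 1ℚ :- u) :+ p :* u) := q :- (p :- u)) refl

  eventually-half : ∀ {P} → Eventually P → Eventually (λ t → P (half t))
  eventually-half (N , p) = N ℕ.+ N , λ t N+N≤t →
    p (half t) (subst (ℕ._≤ half t) (half-double N) (half-mono N+N≤t))

  level-small : ∀ δ → 0ℚ ℚ.< δ → Eventually λ s → unit (level s) ℚ.≤ δ
  level-small δ 0<δ with archimedean δ 0<δ
  ... | j , small = eventually-map (λ {s} j<l → small (level s) (ℕₚ.<⇒≤ j<l)) (level→∞ j)

  -- Convergence and computability of the new sequence

  b-converges : Converges b α
  b-converges ε 0<ε = eventually-map {λ t → Near (half t)} (λ {t} → step {t})
    (eventually-half {Near}
      (eventually-× (level-small (½ ℚ.* ε) (0<½* 0<ε))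
        (shifted {λ s → Close α (½ ℚ.* ε) (a s)} (conv (½ ℚ.* ε) (0<½* 0<ε)))))
    where
    Near : ℕ → Set
    Near s = unit (level s) ℚ.≤ ½ ℚ.* ε × Close α (½ ℚ.* ε) (a (suc s))
    shifted : ∀ {P} → Eventually P → Eventually (λ s → P (suc s))
    shifted (N , p) = N , λ s N≤s → p (suc s) (ℕₚ.m≤n⇒m≤1+n N≤s)
    eq₁ : ∀ p q r e → (½ ℚ.* e ℚ.+ (p ℚ.+ ½ ℚ.* e)) ℚ.- ((p ℚ.- r) ℚ.+ (q ℚ.+ 0ℚ)) ≡ e ℚ.- (q ℚ.- r)
    eq₁ = solve 4 (λ p q r e →
      (con ½ :* e :+ (p :+ con ½ :* e)) :- ((p :- r) :+ (q :+ con 0ℚ)) := e :- (q :- r)) refl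
    eq₂ : ∀ p q r e u →
      (½ ℚ.* e ℚ.+ (q ℚ.+ ½ ℚ.* e)) ℚ.- ((r ℚ.- p) ℚ.+ ((p ℚ.- u) ℚ.+ u)) ≡ e ℚ.- (r ℚ.- q)
    eq₂ = solve 5 (λ p q r e u →
      (con ½ :* e :+ (q :+ con ½ :* e)) :- ((r :- p) :+ ((p :- u) :+ u)) := e :- (r :- q)) refl
    step : ∀ {t} → Near (half t) → Close α ε (b t)
    step {t} (small , close) = eventually-map (λ {n} le → p-q≤e⇒∣p-q∣≤e {b t} {seq α n}
      (≤-by-difference
        (∣p-q∣≤e⇒p-q≤e {p} {seq α n} le ⊹ (b≤a t ⊹ ℚₚ.<⇒≤ (0<½* 0<ε)))
        (eq₁ p (b t) (seq α n) ε))
      (≤-by-difference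
        (∣p-q∣≤e⇒q-p≤e {p} {seq α n} le ⊹ (a-unit≤b t ⊹ small))
        (eq₂ p (b t) (seq α n) ε (unit (level (half t)))))) close
      where p = a (suc (half t))

  b-computable : Computable x → Computable d → ComputableℚSeq b
  b-computable x-comp d-comp =
    num , (λ _ → 0) , den ,
    curried (apply₂ *-computable x′ (apply₂ +-computable l (apply bit-computable (var 0F)))) ,
    curried (const-recursive 0) ,
    curried (apply₂ +-computable l (apply₂ *-computable d′ (apply suc-computable l))) ,
    λ t → sym (trans (/≡ι*unit (num t) (den t)) (b≡ t))
    where
    num den : ℕ → ℕ
    num t = x (suc (half t)) ℕ.* (level (half t) ℕ.+ bit t)
    -- `suc (den t)` is the product of `suc (d (suc (half t)))` and `suc (level (half t))`, in the
    -- form used by `unit-*`; the fraction may be unreduced.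
    den t = level (half t) ℕ.+ d (suc (half t)) ℕ.* suc (level (half t))
    h = apply half-computable (var {1} 0F)
    l = apply (level-computable (gridFloor-computable x-comp d-comp)) h
    x′ = apply x-comp (apply suc-computable h)
    d′ = apply d-comp (apply suc-computable h)
    interchange : ∀ p q r s → (p ℚ.* q) ℚ.* (r ℚ.* s) ≡ (p ℚ.* r) ℚ.* (q ℚ.* s)
    interchange = solve 4 (λ p q r s → (p :* q) :* (r :* s) := (p :* r) :* (q :* s)) refl
    b≡ : ∀ t → ι (num t) ℚ.* unit (den t) ≡ b t
    b≡ t = trans
      (cong₂ ℚ._*_ (ι-* (x (suc (half t))) (level (half t) ℕ.+ bit t))
        (sym (unit-* (d (suc (half t))) (level (half t)))))
      (trans (interchange (ι (x (suc (half t)))) (ι (level (half t) ℕ.+ bit t))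
               (unit (d (suc (half t)))) (unit (level (half t))))
        (cong (ℚ._* weight t) (sym (a≡ (suc (half t))))))

  -- Speed of the new sequence

  -- The detour is proportional to `a`, so it is of order `unit k` only if `a` stays away from 0;
  -- positivity of `α` provides the constant.
  bounded-away : ∃ λ c → 0ℚ ℚ.< c × Eventually λ s → c ℚ.≤ a s
  bounded-away = ½ ℚ.* ε , 0<½* 0<ε , eventually-map above (conv (½ ℚ.* ε) (0<½* 0<ε))
    where
    ε : ℚ
    ε = proj₁ 0<α
    0<ε : 0ℚ ℚ.< ε
    0<ε = proj₁ (proj₂ 0<α)
    ε≤α : Eventually λ n → 0ℚ ℚ.+ ε ℚ.≤ seq α n
    ε≤α = proj₂ (proj₂ 0<α)
    eq : ∀ ε p r → (½ ℚ.* ε ℚ.+ r) ℚ.- ((r ℚ.- p) ℚ.+ (0ℚ ℚ.+ ε)) ≡ p ℚ.- ½ ℚ.* ε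
    eq = solve 3 (λ ε p r →
      (con ½ :* ε :+ r) :- ((r :- p) :+ (con 0ℚ :+ ε)) := p :- con ½ :* ε) refl
    above : ∀ {s} → Close α (½ ℚ.* ε) (a s) → ½ ℚ.* ε ℚ.≤ a s
    above {s} close with eventually-witness (eventually-× close ε≤α)
    ... | n , le , ge = ≤-by-difference (∣p-q∣≤e⇒q-p≤e {a s} {seq α n} le ⊹ ge) (eq ε (a s) (seq α n))

  private
    2ℚ : ℚ
    2ℚ = 1ℚ ℚ.+ 1ℚ

  -- With r close to α: the error of p is at most 2 u², that of the detour at least c u - 2 u².
  ratio-bound : ∀ η c u p r → 0ℚ ℚ.≤ η → 0ℚ ℚ.≤ u → c ℚ.≤ p →
    u ℚ.* (2ℚ ℚ.+ 2ℚ ℚ.* η) ℚ.≤ η ℚ.* c → ℚ.∣ p ℚ.- r ∣ ℚ.≤ u ℚ.* u ℚ.+ u ℚ.* u →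
    ℚ.∣ r ℚ.- p ∣ ℚ.≤ η ℚ.* ℚ.∣ r ℚ.- p ℚ.* (1ℚ ℚ.- u) ∣
  ratio-bound η c u p r 0≤η 0≤u c≤p small close = ℚₚ.≤-trans
    (subst (ℚ._≤ u ℚ.* u ℚ.+ u ℚ.* u) flip close)
    (ℚₚ.≤-trans
      (≤-by-difference
        (*-monoˡ-≤ 0≤u small ⊹ (*-monoˡ-≤ 0≤η (*-monoˡ-≤ 0≤u c≤p) ⊹
          *-monoˡ-≤ 0≤η (∣p-q∣≤e⇒p-q≤e {p} {r} close)))
        (eq η c u p r))
      (*-monoˡ-≤ 0≤η (p≤∣p∣ (r ℚ.- p ℚ.* (1ℚ ℚ.- u)))))
    where
    flip : ℚ.∣ p ℚ.- r ∣ ≡ ℚ.∣ r ℚ.- p ∣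
    flip = trans (sym (ℚₚ.∣-p∣≡∣p∣ (p ℚ.- r))) (cong ℚ.∣_∣ (neg-sub p r))
    eq : ∀ η c u p r →
      (u ℚ.* (η ℚ.* c) ℚ.+ (η ℚ.* (u ℚ.* p) ℚ.+ η ℚ.* (u ℚ.* u ℚ.+ u ℚ.* u))) ℚ.-
      (u ℚ.* (u ℚ.* (2ℚ ℚ.+ 2ℚ ℚ.* η)) ℚ.+ (η ℚ.* (u ℚ.* c) ℚ.+ η ℚ.* (p ℚ.- r)))
      ≡ η ℚ.* (r ℚ.- p ℚ.* (1ℚ ℚ.- u)) ℚ.- (u ℚ.* u ℚ.+ u ℚ.* u)
    eq = solve 5 (λ η c u p r →
      (u :* (η :* c) :+ (η :* (u :* p) :+ η :* (u :* u :+ u :* u))) :-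
      (u :* (u :* (con 2ℚ :+ con 2ℚ :* η)) :+ (η :* (u :* c) :+ η :* (p :- r)))
      := η :* (r :- p :* (con 1ℚ :- u)) :- (u :* u :+ u :* u)) refl

  -- With `u = unit (level s)`, this is the requirement `2 u² ≤ η (c u - 2 u²)` divided by `u`: the
  -- error of the true value against `η` times that of the detour.
  eventually-small : ∀ η c → 0ℚ ℚ.< η → 0ℚ ℚ.< c →
    Eventually λ s → unit (level s) ℚ.* (2ℚ ℚ.+ 2ℚ ℚ.* η) ℚ.≤ η ℚ.* c
  eventually-small η c 0<η 0<c = eventually-map
    (λ {s} le → subst (unit (level s) ℚ.* K ℚ.≤_) cancel (*-monoʳ-≤ (ℚₚ.<⇒≤ 0<K) le))
    (level-small (η ℚ.* c ℚ.* (ℚ.1/ K))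
      (*-positive (*-positive 0<η 0<c) (ℚₚ.positive⁻¹ (ℚ.1/ K) {{ℚₚ.1/pos⇒pos K}})))
    where
    K = 2ℚ ℚ.+ 2ℚ ℚ.* η
    0<2 : 0ℚ ℚ.< 2ℚ
    0<2 = ℚₚ.positive⁻¹ 2ℚ
    0<K : 0ℚ ℚ.< K
    0<K = ℚₚ.+-mono-< 0<2 (*-positive 0<2 0<η)
    instance
      K-positive : ℚ.Positive K
      K-positive = ℚ.positive 0<K
      K-nonZero : ℚ.NonZero K
      K-nonZero = ℚₚ.pos⇒nonZero K
    cancel : η ℚ.* c ℚ.* (ℚ.1/ K) ℚ.* K ≡ η ℚ.* c
    cancel = trans (ℚₚ.*-assoc (η ℚ.* c) (ℚ.1/ K) K)
      (trans (cong (η ℚ.* c ℚ.*_) (ℚₚ.*-inverseˡ K)) (ℚₚ.*-identityʳ (η ℚ.* c)))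

  b-double : ∀ s → b (s ℕ.+ s) ≡ a (suc s) ℚ.* (1ℚ ℚ.- unit (level s))
  b-double s = subst (λ h → b (s ℕ.+ s) ≡ a (suc h) ℚ.* (1ℚ ℚ.- unit (level h))) (half-double s)
    (cong (a (suc (half (s ℕ.+ s))) ℚ.*_) (weight-even (s ℕ.+ s) (bit-double s)))

  b-suc-double : ∀ s → b (suc (s ℕ.+ s)) ≡ a (suc s)
  b-suc-double s = trans
    (cong (a (suc (half (suc (s ℕ.+ s)))) ℚ.*_) (weight-odd (suc (s ℕ.+ s)) (cong (1 ∸_) (bit-double s))))
    (trans (ℚₚ.*-identityʳ _) (cong (λ h → a (suc h)) half≡))
    where
    half≡ : half (s ℕ.+ s) ℕ.+ bit (s ℕ.+ s) ≡ s
    half≡ = trans (cong₂ ℕ._+_ (half-double s) (bit-double s)) (ℕₚ.+-identityʳ s)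

  -- At index `t + t` the ratio has the error of `a (suc t)` above and the error of its detour
  -- below.
  small-at : ∀ η c t → 0ℚ ℚ.< η → c ℚ.≤ a (suc t) →
    unit (level t) ℚ.* (2ℚ ℚ.+ 2ℚ ℚ.* η) ℚ.≤ η ℚ.* c →
    Close α (cell (level t) ℚ.+ cell (level t)) (a (suc t)) →
    Eventually λ n → seq (ratio em b α irr (t ℕ.+ t)) n ℚ.≤ η
  small-at η c t 0<η c≤a tiny = eventually-map λ {n} near →
    ∣÷∣-bound (seq α n ℚ.- b (suc (t ℕ.+ t))) (seq α n ℚ.- b (t ℕ.+ t)) η (ℚₚ.<⇒≤ 0<η)
      (subst₂ (λ p q → ℚ.∣ seq α n ℚ.- p ∣ ℚ.≤ η ℚ.* ℚ.∣ seq α n ℚ.- q ∣)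
        (sym (b-suc-double t)) (sym (b-double t))
        (ratio-bound η c (unit (level t)) (a (suc t)) (seq α n) (ℚₚ.<⇒≤ 0<η) (0≤unit (level t))
          c≤a tiny near))

  b-speedable : Liminf (ratio em b α irr) ≤ 0ℝ
  b-speedable = liminf-≤0 (ratio em b α irr)
    (λ s n → ℚₚ.0≤∣p∣ ((seq α n ℚ.- b (suc s)) ℚ.* recip (seq α n ℚ.- b s))) small
    where
    small : ∀ η → 0ℚ ℚ.< η → ∀ S →
            ∃ λ s → S ℕ.≤ s × Eventually λ n → seq (ratio em b α irr s) n ℚ.≤ η
    small η 0<η S =
      let c , 0<c , c≤a = bounded-away
          N , good      = eventually-× c≤a (eventually-small η c 0<η 0<c)
          -- Passing `S` makes the index late enough, and passing `N` brings the bounds on `a` and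
          -- on the level into force.
          t , ≤t , near = settled-stage (S ℕ.⊔ N)
          N≤t           = ℕₚ.m⊔n≤o⇒n≤o S N ≤t
      in t ℕ.+ t , ℕₚ.≤-trans (ℕₚ.m⊔n≤o⇒m≤o S N ≤t) (ℕₚ.m≤m+n t t) ,
         small-at η c t 0<η (proj₁ (good (suc t) (ℕₚ.m≤n⇒m≤1+n N≤t))) (proj₂ (good t N≤t)) near

  b-approximates : Computable x → Computable d → IsComputableApproximation b α
  b-approximates x-comp d-comp = record
    { 0≤a        = λ t → *-nonNegative (0≤a (suc (half t))) (0≤weight t)
    ; a≤1        = λ t → ℚₚ.≤-trans (b≤a t) (a≤1 (suc (half t)))
    ; converges  = Converges⇒⟶ {b} {α} b-converges
    ; computable = b-computable x-comp d-comp
    }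

theorem3p4 : (em : ExcludedMiddle 0ℓ) →
    (α : ℝ) → 0ℝ < α → α < 1ℝ →
    ComputablyApproximable α → StronglyCAZeroSpeedable em α
theorem3p4 em α 0<α _ (a , approx) with em {Rational α}
... | yes rational = a , approx , inj₁ rational
... | no  irr with IsComputableApproximation.computable approx
...   | p , n , d , p-comp , n-comp , d-comp , a≡ =
  b , b-approximates x-comp d-comp , inj₂ (irr , b-speedable)
  where
  open IsComputableApproximation approx
  x-comp : Computable (λ s → p s ∸ n s)
  x-comp = curried (apply₂ ∸-computable (apply p-comp (var 0F)) (apply n-comp (var 0F)))
  open Construction em α 0<α irr (λ s → p s ∸ n s) d a
    (λ s → trans (a≡ s) (truncate (p s) (n s) (d s) (subst (0ℚ ℚ.≤_) (a≡ s) (0≤a s))))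
    0≤a a≤1 (⟶⇒Converges {a} {α} converges)
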